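{- Let $q\geq 7$ be a power of an odd prime. There is a function $\omega:\mathbb{N}\to\mathbb{R}$ with $\omega(n)\to\infty$ as $n\to\infty$ such that every $[n,k,6]_q$ code satisfies \[ k\leq n - 2\log_q n - \omega(n). \]
   Context: An $[n,k,d]_q$ code is a $k$-dimensional linear subspace $\mathcal{C}$ of $\mathbb{F}_q^n$ whose minimum distance is $d$, i.e. the minimum Hamming distance between two distinct codewords (equivalently the minimum number of nonzero entries of a nonzero codeword) equals $d$. -}

module Defs where

open import Data.Nat using (ℕ; zero; suc; _^_; _≤_)
open import Data.Nat.Primality using (Prime)
open import Data.Fin using (Fin)
import Data.Fin as Fin
open import Data.Product using (Σ; ∃; _×_; _,_)
open import Data.Empty using (⊥)
open import Relation.Nullary using (¬_; Dec; yes; no)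
open import Relation.Binary.PropositionalEquality using (_≡_)
open import Function.Bundles using (_↔_)

record Field : Set₁ where
  field
    Carrier : Set
    _+_ _*_ : Carrier → Carrier → Carrier
    -_      : Carrier → Carrier
    0# 1#   : Carrier
    _≟_     : (x y : Carrier) → Dec (x ≡ y)
    +-assoc : ∀ x y z → (x + y) + z ≡ x + (y + z)
    +-comm  : ∀ x y → x + y ≡ y + x
    +-idˡ   : ∀ x → 0# + x ≡ x
    -‿invˡ  : ∀ x → (- x) + x ≡ 0#
    *-assoc : ∀ x y z → (x * y) * z ≡ x * (y * z)
    *-comm  : ∀ x y → x * y ≡ y * x
    *-idˡ   : ∀ x → 1# * x ≡ x
    distribˡ : ∀ x y z → x * (y + z) ≡ (x * y) + (x * z)
    0≢1     : ¬ (0# ≡ 1#)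
    inverse : ∀ x → ¬ (x ≡ 0#) → Σ Carrier (λ y → y * x ≡ 1#)

record FiniteField (q : ℕ) : Set₁ where
  field
    field′ : Field
  open Field field′ public
  field
    enumeration : Fin q ↔ Carrier

OddPrimePower : ℕ → Set
OddPrimePower q = ∃ λ p → ∃ λ m → Prime p × ¬ (p ≡ 2) × 1 ≤ m × q ≡ p ^ m

module Coding {q : ℕ} (F : FiniteField q) where
  open FiniteField F

  Word : ℕ → Set
  Word n = Fin n → Carrier

  zeroWord : ∀ {n} → Word n
  zeroWord _ = 0#

  count : ∀ {n} → (Fin n → Carrier) → ℕ
  count {zero}  c = 0
  count {suc n} c with c Fin.zero ≟ 0#
  ... | yes _ = count {n} (λ i → c (Fin.suc i))
  ... | no  _ = suc (count {n} (λ i → c (Fin.suc i)))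

  wt : ∀ {n} → Word n → ℕ
  wt = count

  lincomb : ∀ {k n} → (Fin k → Carrier) → (Fin k → Word n) → Word n
  lincomb {zero}  x G i = 0#
  lincomb {suc k} x G i = (x Fin.zero * G Fin.zero i) + lincomb {k} (λ j → x (Fin.suc j)) (λ j → G (Fin.suc j)) i

  IsZero : ∀ {m} → (Fin m → Carrier) → Set
  IsZero x = ∀ i → x i ≡ 0#

  LinIndep : ∀ {k n} → (Fin k → Word n) → Set
  LinIndep {k} G = ∀ (x : Fin k → Carrier) → IsZero (lincomb x G) → IsZero x

  -- An [n,k,d]_q code: the k-dimensional subspace of F_q^n spanned by the
  -- k linearly independent rows of a generator matrix G (a basis of the code),
  -- whose minimum distance (minimum weight of a nonzero codeword) is exactly d.
  record LinearCode (n k d : ℕ) : Set where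
    field
      G         : Fin k → Word n
      indep     : LinIndep G
      min-dist  : ∀ (x : Fin k → Carrier) → ¬ IsZero (lincomb x G) → d ≤ wt (lincomb x G)
      attained  : Σ (Fin k → Carrier) (λ x → ¬ IsZero (lincomb x G) × wt (lincomb x G) ≡ d)

{-# OPTIONS --safe #-}

-- The columns h_1, ..., h_n of a parity check matrix lie in F^r, r = n - k, and
-- any five of them are independent.  Choose α, β with α, β, α + β ∉ {0, 1, -1},
-- which is possible once q ≥ 7.  Then a relation
--   h_i + α h_j - h_i′ + β h_j′ - (α + β) h_l = 0
-- forces i = i′ and j = j′ = l, so the left-hand sides, fed to the indicator
-- function of 0 ∈ F^r, give a matrix indexed by pairs (i , j), (i′ , j′) for each
-- l, whose combination with weights g_l is diagonal with entries g_j.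
--
-- As in the Croot-Lev-Pach method, the indicator function is a combination of
-- monomials u^e w^f x^h in the three summands, with |e| + |f| + |h| ≤ (q - 1) r
-- and individual exponents at most q - 1.  Weights g that annihilate all x^h with
-- |h| < D can be taken equal to 1 except at as many places as there are such h;
-- what remains has |e| or |f| at most ((q - 1) r - D) / 2.  Comparing ranks, n²
-- is at most a constant times the number of such e.  With D = r / 3 the excluded
-- h number at most 2^(r + D), which is o(q^(r/2)) because 4⁴ < 7³, and by
-- Chebyshev's inequality the remaining e are o(q^r).  Hence n² = o(q^r).

module Submission where

open import Defs
open import Algebra.Bundles using (CommutativeRing)
open import Data.Fin using (Fin; zero; suc; punchIn; remQuot; combine)
open import Data.Fin.Properties using (all?; any?; ¬∀⟶∃¬; combine-remQuot; injective⇒≤; punchInᵢ≢i; punchIn-injective)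
import Data.Fin.Properties as Fin
open import Data.List as List using (List; []; _∷_; _++_; length; lookup; map; filter; downFrom; cartesianProductWith)
open import Data.List.Properties
  using (length-downFrom; length-filter; filter-accept; filter-reject; filter-notAll; length-map; length-++; length-tabulate; map-++; map-∘)
import Data.List.Membership.DecPropositional as DecMembership
open import Data.List.Membership.Propositional using (_∈_; _∉_)
open import Data.List.Membership.Propositional.Properties
  using (∈-allFin; ∈-downFrom⁺; ∈-downFrom⁻; ∈-cartesianProductWith⁺; ∈-filter⁺; ∈-map⁺; ∈-++⁺ˡ; ∈-++⁺ʳ)
open import Data.List.Relation.Unary.Any as Any using (here; there)
open import Data.List.Relation.Unary.Any.Properties using (lookup-index)
open import Data.Nat as ℕ using (ℕ; zero; suc; s≤s; z≤n)
import Data.Nat.Properties as ℕ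
open import Data.Nat.Tactic.RingSolver using (solve-∀)
open import Data.Product using (∃; _×_; _,_; proj₁; proj₂)
open import Data.Sum using (_⊎_; inj₁; inj₂)
open import Data.Vec as Vec using (Vec; []; _∷_)
open import Data.Vec.Relation.Unary.All using (All; []; _∷_)
open import Function using (_∘_; Inverse)
open import Level using (0ℓ)
open import Relation.Binary.PropositionalEquality
open import Relation.Nullary using (¬_; yes; no; contradiction)
open import Relation.Nullary.Decidable using (¬?; decidable-stable)

-- Counting exponent vectors

module Counting where
  open import Data.Nat using (_+_; _*_; _∸_; _^_; _/_; _%_; _≤_; _<_; _≤?_; s≤s⁻¹; NonZero; >-nonZero)
  open import Data.Nat.DivMod using (m≡m%n+[m/n]*n; m%n<n; /-monoˡ-≤; m*n/n≡m)
  open import Data.Nat.ListAction using (sum)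
  open import Data.Nat.ListAction.Properties using (sum-++)
  open import Data.Nat.Properties

  -- Finite sums and Chebyshev's inequality

  ∑ : ∀ {A : Set} → List A → (A → ℕ) → ℕ
  ∑ xs f = sum (map f xs)

  ∑-cong : ∀ {A : Set} {f g : A → ℕ} xs → (∀ x → f x ≡ g x) → ∑ xs f ≡ ∑ xs g
  ∑-cong []       f≗g = refl
  ∑-cong (x ∷ xs) f≗g = cong₂ _+_ (f≗g x) (∑-cong xs f≗g)

  ∑-≤ : ∀ {A : Set} (f : A → ℕ) {c} xs → (∀ {x} → x ∈ xs → f x ≤ c) → ∑ xs f ≤ length xs * c
  ∑-≤ f []       f≤c = z≤n
  ∑-≤ f (x ∷ xs) f≤c = +-mono-≤ (f≤c (here refl)) (∑-≤ f xs (f≤c ∘ there))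

  ∑-affine : ∀ {A : Set} (f : A → ℕ) b c xs → ∑ xs (λ x → b + c * f x) ≡ length xs * b + c * ∑ xs f
  ∑-affine f b c []       = sym (*-zeroʳ c)
  ∑-affine f b c (x ∷ xs) = trans (cong (b + c * f x +_) (∑-affine f b c xs)) (lemma b c (f x) (length xs) (∑ xs f))
    where
    lemma : ∀ b c y l s → b + c * y + (l * b + c * s) ≡ (b + l * b) + c * (y + s)
    lemma = solve-∀

  ∑-+ : ∀ {A : Set} (f g : A → ℕ) xs → ∑ xs (λ x → f x + g x) ≡ ∑ xs f + ∑ xs g
  ∑-+ f g []       = refl
  ∑-+ f g (x ∷ xs) = trans (cong (f x + g x +_) (∑-+ f g xs)) (lemma (f x) (g x) (∑ xs f) (∑ xs g))
    where
    lemma : ∀ a b c d → a + b + (c + d) ≡ a + c + (b + d)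
    lemma = solve-∀

  ∑-cartesianProductWith : ∀ {A B C : Set} (_·_ : A → B → C) (f : C → ℕ) xs ys →
    ∑ (cartesianProductWith _·_ xs ys) f ≡ ∑ xs (λ x → ∑ ys (λ y → f (x · y)))
  ∑-cartesianProductWith _·_ f []       ys = refl
  ∑-cartesianProductWith _·_ f (x ∷ xs) ys = begin
    sum (map f (map (x ·_) ys ++ cartesianProductWith _·_ xs ys))
      ≡⟨ cong sum (map-++ f (map (x ·_) ys) _) ⟩
    sum (map f (map (x ·_) ys) ++ map f (cartesianProductWith _·_ xs ys))
      ≡⟨ sum-++ (map f (map (x ·_) ys)) _ ⟩
    sum (map f (map (x ·_) ys)) + ∑ (cartesianProductWith _·_ xs ys) f
      ≡⟨ cong₂ _+_ (cong sum (sym (map-∘ ys))) (∑-cartesianProductWith _·_ f xs ys) ⟩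
    ∑ ys (λ y → f (x · y)) + ∑ xs (λ x → ∑ ys (λ y → f (x · y))) ∎
    where open ≡-Reasoning

  length-cartesianProductWith : ∀ {A B C : Set} (_·_ : A → B → C) xs ys →
    length (cartesianProductWith _·_ xs ys) ≡ length xs * length ys
  length-cartesianProductWith _·_ []       ys = refl
  length-cartesianProductWith _·_ (x ∷ xs) ys = trans (length-++ (map (x ·_) ys))
    (cong₂ _+_ (length-map (x ·_) ys) (length-cartesianProductWith _·_ xs ys))

  2mn≤m²+n² : ∀ m n → 2 * (m * n) ≤ m * m + n * n
  2mn≤m²+n² m n with ≤-total m n
  ... | inj₁ m≤n = subst (λ n → 2 * (m * n) ≤ m * m + n * n) (m+[n∸m]≡n m≤n) (shifted m (n ∸ m))
    where
    square : ∀ m d → 2 * (m * (m + d)) + d * d ≡ m * m + (m + d) * (m + d)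
    square = solve-∀
    shifted : ∀ m d → 2 * (m * (m + d)) ≤ m * m + (m + d) * (m + d)
    shifted m d = ≤-trans (m≤m+n _ (d * d)) (≤-reflexive (square m d))
  ... | inj₂ n≤m = subst (λ m → 2 * (m * n) ≤ m * m + n * n) (m+[n∸m]≡n n≤m) (shifted n (m ∸ n))
    where
    square : ∀ n d → 2 * ((n + d) * n) + d * d ≡ (n + d) * (n + d) + n * n
    square = solve-∀
    shifted : ∀ n d → 2 * ((n + d) * n) ≤ (n + d) * (n + d) + n * n
    shifted n d = ≤-trans (m≤m+n _ (d * d)) (≤-reflexive (square n d))

  -- This is `(n - m)² ≥ D²` with the cross term moved to the left, so that no truncated subtraction
  -- occurs.
  gap² : ∀ {m D n} → m + D ≤ n → D * D + 2 * (m * n) ≤ m * m + n * n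
  gap² {m} {D} {n} m+D≤n = subst (λ n → D * D + 2 * (m * n) ≤ m * m + n * n) (m+[n∸m]≡n m+D≤n) (shifted (n ∸ (m + D)))
    where
    square : ∀ m D t → D * D + 2 * (m * (m + D + t)) + (2 * (D * t) + t * t) ≡ m * m + (m + D + t) * (m + D + t)
    square = solve-∀
    shifted : ∀ t → D * D + 2 * (m * (m + D + t)) ≤ m * m + (m + D + t) * (m + D + t)
    shifted t = ≤-trans (m≤m+n _ _) (≤-reflexive (square m D t))

  -- In the sum of `(f x - c)²` every `x` with `f x + D ≤ c` contributes at least `D²` and every
  -- other one at least 0. The cross terms stand on the left to stay within ℕ.
  chebyshev : ∀ {A : Set} (f : A → ℕ) D c xs →
    length (filter (λ x → f x + D ≤? c) xs) * (D * D) + ∑ xs (λ x → 2 * (f x * c)) ≤ ∑ xs (λ x → f x * f x + c * c)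
  chebyshev f D c []       = z≤n
  chebyshev f D c (x ∷ xs) with f x + D ≤? c
  ... | yes far rewrite filter-accept (λ x → f x + D ≤? c) {xs = xs} far = begin
    D * D + l * (D * D) + (2 * (f x * c) + s) ≡⟨ lemma (D * D) (l * (D * D)) (2 * (f x * c)) s ⟩
    D * D + 2 * (f x * c) + (l * (D * D) + s) ≤⟨ +-mono-≤ (gap² {f x} far) (chebyshev f D c xs) ⟩
    ∑ (x ∷ xs) (λ x → f x * f x + c * c)      ∎
    where
    open ≤-Reasoning
    l = length (filter (λ x → f x + D ≤? c) xs)
    s = ∑ xs (λ x → 2 * (f x * c))
    lemma : ∀ a b c d → a + b + (c + d) ≡ a + c + (b + d)
    lemma = solve-∀
  ... | no near rewrite filter-reject (λ x → f x + D ≤? c) {xs = xs} near = begin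
    l * (D * D) + (2 * (f x * c) + s) ≡⟨ lemma (l * (D * D)) (2 * (f x * c)) s ⟩
    2 * (f x * c) + (l * (D * D) + s) ≤⟨ +-mono-≤ (2mn≤m²+n² (f x) c) (chebyshev f D c xs) ⟩
    ∑ (x ∷ xs) (λ x → f x * f x + c * c) ∎
    where
    open ≤-Reasoning
    l = length (filter (λ x → f x + D ≤? c) xs)
    s = ∑ xs (λ x → 2 * (f x * c))
    lemma : ∀ b c d → b + (c + d) ≡ c + (b + d)
    lemma = solve-∀

  ∑-downFrom : ∀ n → ∑ (downFrom (suc n)) (2 *_) ≡ n * suc n
  ∑-downFrom zero    = refl
  ∑-downFrom (suc n) = trans (cong (2 * suc n +_) (∑-downFrom n)) (lemma n)
    where
    lemma : ∀ n → 2 * suc n + n * suc n ≡ suc n * suc (suc n)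
    lemma = solve-∀

  -- Moments of the degree over a box of exponents

  box : ℕ → (r : ℕ) → List (Vec ℕ r)
  box Q zero    = [] ∷ []
  box Q (suc r) = cartesianProductWith _∷_ (downFrom (suc Q)) (box Q r)

  ∈-box : ∀ {Q r} {e : Vec ℕ r} → All (_≤ Q) e → e ∈ box Q r
  ∈-box []         = here refl
  ∈-box (a≤Q ∷ e≤Q) = ∈-cartesianProductWith⁺ _∷_ (∈-downFrom⁺ (s≤s a≤Q)) (∈-box e≤Q)

  length-box : ∀ Q r → length (box Q r) ≡ suc Q ^ r
  length-box Q zero    = refl
  length-box Q (suc r) = trans (length-cartesianProductWith _∷_ (downFrom (suc Q)) (box Q r))
    (cong₂ _*_ (length-downFrom (suc Q)) (length-box Q r))

  degree : ∀ {r} → Vec ℕ r → ℕ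
  degree = Vec.sum

  -- A uniform exponent in `0, ..., Q` has mean `Q / 2`; doubling the degree makes its mean the
  -- integer `Q * r`.
  first-moment : ∀ Q r → ∑ (box Q r) (λ e → 2 * degree e) ≡ Q * r * suc Q ^ r
  first-moment Q zero    = sym (trans (*-identityʳ (Q * 0)) (*-zeroʳ Q))
  first-moment Q (suc r) = begin
    ∑ (box Q (suc r)) (λ e → 2 * degree e)
      ≡⟨ ∑-cartesianProductWith _∷_ (λ e → 2 * degree e) (downFrom (suc Q)) (box Q r) ⟩
    ∑ (downFrom (suc Q)) (λ a → ∑ (box Q r) (λ e → 2 * (a + degree e)))
      ≡⟨ ∑-cong (downFrom (suc Q)) inner ⟩
    ∑ (downFrom (suc Q)) (λ a → Q * r * p + p * (2 * a))
      ≡⟨ ∑-affine (2 *_) (Q * r * p) p (downFrom (suc Q)) ⟩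
    length (downFrom (suc Q)) * (Q * r * p) + p * ∑ (downFrom (suc Q)) (2 *_)
      ≡⟨ cong₂ (λ l s → l * (Q * r * p) + p * s) (length-downFrom (suc Q)) (∑-downFrom Q) ⟩
    suc Q * (Q * r * p) + p * (Q * suc Q)
      ≡⟨ lemma Q r p ⟩
    Q * suc r * (suc Q * p) ∎
    where
    open ≡-Reasoning
    p = suc Q ^ r
    inner : ∀ a → ∑ (box Q r) (λ e → 2 * (a + degree e)) ≡ Q * r * p + p * (2 * a)
    inner a = begin
      ∑ (box Q r) (λ e → 2 * (a + degree e))
        ≡⟨ ∑-cong (box Q r) (λ e → distrib a (degree e)) ⟩
      ∑ (box Q r) (λ e → 2 * a + 1 * (2 * degree e))
        ≡⟨ ∑-affine (λ e → 2 * degree e) (2 * a) 1 (box Q r) ⟩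
      length (box Q r) * (2 * a) + 1 * ∑ (box Q r) (λ e → 2 * degree e)
        ≡⟨ cong₂ (λ l s → l * (2 * a) + 1 * s) (length-box Q r) (first-moment Q r) ⟩
      p * (2 * a) + 1 * (Q * r * p)
        ≡⟨ swap (p * (2 * a)) (Q * r * p) ⟩
      Q * r * p + p * (2 * a) ∎
      where
      distrib : ∀ a d → 2 * (a + d) ≡ 2 * a + 1 * (2 * d)
      distrib = solve-∀
      swap : ∀ x y → x + 1 * y ≡ y + x
      swap = solve-∀
    lemma : ∀ Q r p → suc Q * (Q * r * p) + p * (Q * suc Q) ≡ Q * suc r * (suc Q * p)
    lemma = solve-∀

  -- The main term `(Q * r)²` must be exact, because `belowMean-rare` cancels it against the squared
  -- mean. Hence the induction evaluates the cross term exactly and estimates only the square of the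
  -- new exponent, by `Q * Q`.
  second-moment : ∀ Q r → ∑ (box Q r) (λ e → 2 * degree e * (2 * degree e)) ≤ Q * Q * (r * r + 3 * r) * suc Q ^ r
  second-moment Q zero    = z≤n
  second-moment Q (suc r) = begin
    ∑ (box Q (suc r)) (λ e → 2 * degree e * (2 * degree e))
      ≡⟨ ∑-cartesianProductWith _∷_ (λ e → 2 * degree e * (2 * degree e)) (downFrom (suc Q)) (box Q r) ⟩
    ∑ (downFrom (suc Q)) (λ a → ∑ (box Q r) (λ e → 2 * (a + degree e) * (2 * (a + degree e))))
      ≡⟨ ∑-cong (downFrom (suc Q)) inner ⟩
    ∑ (downFrom (suc Q)) (λ a → (p * (4 * (a * a)) + m₂) + 2 * m₁ * (2 * a))
      ≡⟨ ∑-+ (λ a → p * (4 * (a * a)) + m₂) (λ a → 2 * m₁ * (2 * a)) (downFrom (suc Q)) ⟩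
    ∑ (downFrom (suc Q)) (λ a → p * (4 * (a * a)) + m₂) + ∑ (downFrom (suc Q)) (λ a → 2 * m₁ * (2 * a))
      ≤⟨ +-mono-≤ (∑-≤ _ (downFrom (suc Q)) bounded) (≤-reflexive (∑-affine (2 *_) 0 (2 * m₁) (downFrom (suc Q)))) ⟩
    length (downFrom (suc Q)) * B
      + (length (downFrom (suc Q)) * 0 + 2 * m₁ * ∑ (downFrom (suc Q)) (2 *_))
      ≡⟨ cong₂ _+_ (cong (_* B) (length-downFrom (suc Q))) (cong₂ _+_ (*-zeroʳ (length (downFrom (suc Q)))) (cong₂ (λ m s → 2 * m * s) (first-moment Q r) (∑-downFrom Q))) ⟩
    suc Q * B + (0 + 2 * (Q * r * p) * (Q * suc Q))
      ≡⟨ lemma Q r p ⟩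
    Q * Q * (suc r * suc r + 3 * suc r) * (suc Q * p) ∎
    where
    open ≤-Reasoning
    p  = suc Q ^ r
    m₁ = ∑ (box Q r) (λ e → 2 * degree e)
    m₂ = ∑ (box Q r) (λ e → 2 * degree e * (2 * degree e))
    B  = p * (4 * (Q * Q)) + Q * Q * (r * r + 3 * r) * p
    bounded : ∀ {a} → a ∈ downFrom (suc Q) → p * (4 * (a * a)) + m₂ ≤ B
    bounded a∈ = let a≤Q = s≤s⁻¹ (∈-downFrom⁻ a∈) in
      +-mono-≤ (*-monoʳ-≤ p (*-monoʳ-≤ 4 (*-mono-≤ a≤Q a≤Q))) (second-moment Q r)
    inner : ∀ a → ∑ (box Q r) (λ e → 2 * (a + degree e) * (2 * (a + degree e)))
                ≡ (p * (4 * (a * a)) + m₂) + 2 * m₁ * (2 * a)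
    inner a = let d = λ e → 2 * degree e in begin-equality
      ∑ (box Q r) (λ e → 2 * (a + degree e) * (2 * (a + degree e)))
        ≡⟨ ∑-cong (box Q r) (λ e → square a (degree e)) ⟩
      ∑ (box Q r) (λ e → d e * d e + (4 * (a * a) + 4 * a * d e))
        ≡⟨ ∑-+ (λ e → d e * d e) (λ e → 4 * (a * a) + 4 * a * d e) (box Q r) ⟩
      m₂ + ∑ (box Q r) (λ e → 4 * (a * a) + 4 * a * d e)
        ≡⟨ cong (m₂ +_) (∑-affine d (4 * (a * a)) (4 * a) (box Q r)) ⟩
      m₂ + (length (box Q r) * (4 * (a * a)) + 4 * a * m₁)
        ≡⟨ cong (λ l → m₂ + (l * (4 * (a * a)) + 4 * a * m₁)) (length-box Q r) ⟩
      m₂ + (p * (4 * (a * a)) + 4 * a * m₁)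
        ≡⟨ regroup m₂ p a m₁ ⟩
      (p * (4 * (a * a)) + m₂) + 2 * m₁ * (2 * a) ∎
      where
      square : ∀ a d → 2 * (a + d) * (2 * (a + d)) ≡ 2 * d * (2 * d) + (4 * (a * a) + 4 * a * (2 * d))
      square = solve-∀
      regroup : ∀ m p a n → m + (p * (4 * (a * a)) + 4 * a * n) ≡ (p * (4 * (a * a)) + m) + 2 * n * (2 * a)
      regroup = solve-∀
    lemma : ∀ Q r p → suc Q * (p * (4 * (Q * Q)) + Q * Q * (r * r + 3 * r) * p) + (0 + 2 * (Q * r * p) * (Q * suc Q))
                    ≡ Q * Q * (suc r * suc r + 3 * suc r) * (suc Q * p)
    lemma = solve-∀

  belowMean : ℕ → (r D : ℕ) → List (Vec ℕ r)
  belowMean Q r D = filter (λ e → 2 * degree e + D ≤? Q * r) (box Q r)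

  ∈-belowMean : ∀ {Q r D} {e : Vec ℕ r} → All (_≤ Q) e → 2 * degree e + D ≤ Q * r → e ∈ belowMean Q r D
  ∈-belowMean e≤Q low = ∈-filter⁺ _ (∈-box e≤Q) low

  length-belowMean : ∀ Q r D → length (belowMean Q r D) ≤ suc Q ^ r
  length-belowMean Q r D = ≤-trans (length-filter _ (box Q r)) (≤-reflexive (length-box Q r))

  -- Chebyshev's inequality for the doubled degree, centred at its mean `Q * r`. The main terms
  -- cancel and leave a variance of at most `3 * (Q * Q) * r`.
  belowMean-rare : ∀ Q r D → length (belowMean Q r D) * (D * D) ≤ 3 * (Q * Q) * r * suc Q ^ r
  -- The cancelled summand `2 * (c * c) * p` is the total of the cross terms, that is, `2 * c` times
  -- the first moment.
  belowMean-rare Q r D = +-cancelʳ-≤ (2 * (c * c) * p) _ _ (begin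
    l * (D * D) + 2 * (c * c) * p
      ≡⟨ cong (l * (D * D) +_) (trans (lemma₁ c p) (cong (2 * c *_) (sym (first-moment Q r)))) ⟩
    l * (D * D) + 2 * c * ∑ (box Q r) d
      ≡⟨ cong (l * (D * D) +_) (trans (cong (_+ 2 * c * ∑ (box Q r) d) (sym (*-zeroʳ (length (box Q r))))) (sym (∑-affine d 0 (2 * c) (box Q r)))) ⟩
    l * (D * D) + ∑ (box Q r) (λ e → 2 * c * d e)
      ≡⟨ cong (l * (D * D) +_) (∑-cong (box Q r) (λ e → lemma₂ c (d e))) ⟩
    l * (D * D) + ∑ (box Q r) (λ e → 2 * (d e * c))
      ≤⟨ chebyshev d D c (box Q r) ⟩
    ∑ (box Q r) (λ e → d e * d e + c * c)
      ≡⟨ ∑-cong (box Q r) (λ e → lemma₃ (d e * d e) (c * c)) ⟩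
    ∑ (box Q r) (λ e → c * c + 1 * (d e * d e))
      ≡⟨ ∑-affine (λ e → d e * d e) (c * c) 1 (box Q r) ⟩
    length (box Q r) * (c * c) + 1 * ∑ (box Q r) (λ e → d e * d e)
      ≤⟨ +-mono-≤ (≤-reflexive (cong (_* (c * c)) (length-box Q r))) (*-monoʳ-≤ 1 (second-moment Q r)) ⟩
    p * (c * c) + 1 * (Q * Q * (r * r + 3 * r) * p)
      ≡⟨ lemma₄ Q r p ⟩
    3 * (Q * Q) * r * p + 2 * (c * c) * p ∎)
    where
    open ≤-Reasoning
    l = length (belowMean Q r D)
    c = Q * r
    p = suc Q ^ r
    d : Vec ℕ r → ℕ
    d e = 2 * degree e
    lemma₁ : ∀ c p → 2 * (c * c) * p ≡ 2 * c * (c * p)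
    lemma₁ = solve-∀
    lemma₂ : ∀ c d → 2 * c * d ≡ 2 * (d * c)
    lemma₂ = solve-∀
    lemma₃ : ∀ x y → x + y ≡ y + 1 * x
    lemma₃ = solve-∀
    lemma₄ : ∀ Q r p → p * (Q * r * (Q * r)) + 1 * (Q * Q * (r * r + 3 * r) * p)
                     ≡ 3 * (Q * Q) * r * p + 2 * (Q * r * (Q * r)) * p
    lemma₄ = solve-∀

  -- Exponents of low degree

  incHead : ∀ {r} → Vec ℕ (suc r) → Vec ℕ (suc r)
  incHead (a ∷ e) = suc a ∷ e

  -- Pascal's recursion for the exponents of degree less than `D`: the first exponent is 0, or it is
  -- lowered by one together with `D`.
  lowDegree : (r D : ℕ) → List (Vec ℕ r)
  lowDegree r       zero    = []
  lowDegree zero    (suc D) = [] ∷ []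
  lowDegree (suc r) (suc D) = map (0 ∷_) (lowDegree r (suc D)) ++ map incHead (lowDegree (suc r) D)

  ∈-lowDegree : ∀ {r D} (e : Vec ℕ r) → degree e < D → e ∈ lowDegree r D
  ∈-lowDegree {D = suc D} []          _         = here refl
  ∈-lowDegree {D = suc D} (zero ∷ e)  e<D       = ∈-++⁺ˡ (∈-map⁺ (0 ∷_) (∈-lowDegree e e<D))
  ∈-lowDegree {suc r} {suc D} (suc a ∷ e) (s≤s e<D) =
    ∈-++⁺ʳ (map (0 ∷_) (lowDegree r (suc D))) (∈-map⁺ incHead (∈-lowDegree (a ∷ e) e<D))

  length-lowDegree-0 : ∀ r → length (lowDegree r 0) ≡ 0
  length-lowDegree-0 zero    = refl
  length-lowDegree-0 (suc r) = refl

  -- Each of the two branches of the recursion lowers `r + D` by one, which costs one factor 2.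
  length-lowDegree : ∀ r D → length (lowDegree r D) ≤ 2 ^ (r + D)
  length-lowDegree r       zero    = z≤n
  length-lowDegree zero    (suc D) = m^n>0 2 (suc D)
  length-lowDegree (suc r) (suc D) = begin
    length (map (0 ∷_) xs ++ map incHead ys)         ≡⟨ length-++ (map (0 ∷_) xs) ⟩
    length (map (0 ∷_) xs) + length (map incHead ys) ≡⟨ cong₂ _+_ (length-map (0 ∷_) xs) (length-map incHead ys) ⟩
    length xs + length ys                            ≤⟨ +-mono-≤ (length-lowDegree r (suc D)) (length-lowDegree (suc r) D) ⟩
    2 ^ (r + suc D) + 2 ^ (suc r + D)                ≡⟨ cong (λ t → 2 ^ (r + suc D) + t) (trans (cong (2 ^_) (sym (+-suc r D))) (sym (+-identityʳ _))) ⟩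
    2 ^ (suc r + suc D)                              ∎
    where
    open ≤-Reasoning
    xs = lowDegree r (suc D)
    ys = lowDegree (suc r) D

  -- Comparison of growth rates

  n*256^n≤3*343^n : ∀ n → n * 256 ^ n ≤ 3 * 343 ^ n
  n*256^n≤3*343^n 0 = z≤n
  n*256^n≤3*343^n 1 = ≤ᵇ⇒≤ _ _ _
  n*256^n≤3*343^n 2 = ≤ᵇ⇒≤ _ _ _
  n*256^n≤3*343^n 3 = ≤ᵇ⇒≤ _ _ _
  -- The left side grows by the factor `256 * (n + 1) / n`, which is below 343 once `n ≥ 3`, since
  -- `256 * 4 = 1024` and `343 * 3 = 1029`.
  n*256^n≤3*343^n (suc n@(suc (suc (suc m)))) = begin
    suc n * (256 * 256 ^ n)    ≡⟨ lemma₁ m (256 ^ n) ⟩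
    (1024 + 256 * m) * 256 ^ n ≤⟨ *-monoˡ-≤ (256 ^ n) (+-mono-≤ (≤ᵇ⇒≤ 1024 1029 _) (*-monoˡ-≤ m (≤ᵇ⇒≤ 256 343 _))) ⟩
    (1029 + 343 * m) * 256 ^ n ≡⟨ lemma₂ m (256 ^ n) ⟩
    343 * (n * 256 ^ n)        ≤⟨ *-monoʳ-≤ 343 (n*256^n≤3*343^n n) ⟩
    343 * (3 * 343 ^ n)        ≡⟨ lemma₃ (343 ^ n) ⟩
    3 * (343 * 343 ^ n)        ∎
    where
    open ≤-Reasoning
    lemma₁ : ∀ m x → (4 + m) * (256 * x) ≡ (1024 + 256 * m) * x
    lemma₁ = solve-∀
    lemma₂ : ∀ m x → (1029 + 343 * m) * x ≡ 343 * ((3 + m) * x)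
    lemma₂ = solve-∀
    lemma₃ : ∀ x → 343 * (3 * x) ≡ 3 * (343 * x)
    lemma₃ = solve-∀

  -- For `r = ρ + 3 * D` the powers to compare are `4 ^ ρ * 256 ^ D` and `7 ^ ρ * 343 ^ D`. The
  -- factor `D / 3` gained in `n*256^n≤3*343^n` absorbs the constant `4 * B`, whence `12 * B ≤ D`.
  4^[4r/3]-negligible : ∀ {q} B r → 7 ≤ q → 12 * B ≤ r / 3 → B * (4 * 4 ^ (r + r / 3)) ≤ q ^ r
  4^[4r/3]-negligible {q} B r 7≤q 12B≤D = *-cancelˡ-≤ 3 (begin
    3 * (B * (4 * 4 ^ (r + D)))   ≡⟨ cong (λ t → 3 * (B * (4 * t))) split₄ ⟩
    3 * (B * (4 * (4 ^ ρ * 256 ^ D))) ≡⟨ lemma₁ B (4 ^ ρ) (256 ^ D) ⟩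
    4 ^ ρ * (12 * B * 256 ^ D)    ≤⟨ *-mono-≤ (^-monoˡ-≤ ρ (≤ᵇ⇒≤ 4 7 _)) (*-monoˡ-≤ (256 ^ D) 12B≤D) ⟩
    7 ^ ρ * (D * 256 ^ D)         ≤⟨ *-monoʳ-≤ (7 ^ ρ) (n*256^n≤3*343^n D) ⟩
    7 ^ ρ * (3 * 343 ^ D)         ≡⟨ lemma₂ (7 ^ ρ) (343 ^ D) ⟩
    3 * (7 ^ ρ * 343 ^ D)         ≡⟨ cong (3 *_) split₇ ⟨
    3 * 7 ^ r                     ≤⟨ *-monoʳ-≤ 3 (^-monoˡ-≤ r 7≤q) ⟩
    3 * q ^ r                     ∎)
    where
    open ≤-Reasoning
    D = r / 3
    ρ = r % 3
    r≡ : r ≡ ρ + 3 * D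
    r≡ = trans (m≡m%n+[m/n]*n r 3) (cong (ρ +_) (*-comm D 3))
    split₇ : 7 ^ r ≡ 7 ^ ρ * 343 ^ D
    split₇ = trans (cong (7 ^_) r≡) (trans (^-distribˡ-+-* 7 ρ (3 * D)) (cong (7 ^ ρ *_) (sym (^-*-assoc 7 3 D))))
    split₄ : 4 ^ (r + D) ≡ 4 ^ ρ * 256 ^ D
    split₄ = trans (cong (4 ^_) (trans (cong (_+ D) r≡) (lemma₃ ρ D)))
      (trans (^-distribˡ-+-* 4 ρ (4 * D)) (cong (4 ^ ρ *_) (sym (^-*-assoc 4 4 D))))
      where
      lemma₃ : ∀ ρ D → ρ + 3 * D + D ≡ ρ + 4 * D
      lemma₃ = solve-∀
    lemma₁ : ∀ b x y → 3 * (b * (4 * (x * y))) ≡ x * (12 * b * y)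
    lemma₁ = solve-∀
    lemma₂ : ∀ x y → x * (3 * y) ≡ 3 * (x * y)
    lemma₂ = solve-∀

  module Asymptotics (Q B : ℕ) (6≤Q : 6 ≤ Q) where

    -- `D₀` exceeds `60 * (B * (Q * Q))` for the contradiction in `quadratic-bound`, and `12 * B`
    -- for `4^[4r/3]-negligible`. From `r₀ ≤ r` follows `D₀ ≤ r / 3`, and `N ≤ n` is to force
    -- `r₀ ≤ r`.
    D₀ r₀ N : ℕ
    D₀ = suc (60 * (B * (Q * Q)) + 12 * B)
    r₀ = D₀ * 3
    N  = suc (2 * suc Q ^ r₀)

    -- A crude first bound `n * n ≤ 2 * suc Q ^ r`, for the case without excluded exponents, where
    -- `n ≤ s`. It shows that a long code has large redundancy.
    r₀≤r : ∀ {n r s K} → N ≤ n → n ≤ s → n * s ≤ 2 * K → K ≤ suc Q ^ r → r₀ ≤ r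
    r₀≤r {n} {r} {s} {K} N≤n n≤s n*s≤2K K≤q^r = ≮⇒≥ (λ r<r₀ → <⇒≱ (begin-strict
      n              ≤⟨ m≤m*n n n ⟩
      n * n          ≤⟨ *-monoʳ-≤ n n≤s ⟩
      n * s          ≤⟨ n*s≤2K ⟩
      2 * K          ≤⟨ *-monoʳ-≤ 2 (≤-trans K≤q^r (^-monoʳ-≤ (suc Q) (<⇒≤ r<r₀))) ⟩
      2 * suc Q ^ r₀ <⟨ N≤n ⟩
      n ∎) ≤-refl)
      where
      open ≤-Reasoning
      instance
        n≢0 : NonZero n
        n≢0 = >-nonZero (≤-trans (s≤s z≤n) N≤n)

    -- L and K stand for the numbers of exponents of low degree and below the mean.
    quadratic-bound : ∀ {n r s L K} → let D = r / 3 in r₀ ≤ r → L ≤ 2 ^ (r + D) → K * (D * D) ≤ 3 * (Q * Q) * r * suc Q ^ r →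
      n ≤ s + L → n * s ≤ 2 * K → B * (n * n) ≤ suc Q ^ r
    -- If the bound fails, then `suc Q ^ r ≤ B * (n * n)`. Since `n * n ≤ 4 * K` and `K` is small,
    -- `D` would stay below `D₀`.
    quadratic-bound {n} {r} {s} {L} {K} r₀≤r L≤ K≤ n≤s+L n*s≤2K with B * (n * n) ≤? suc Q ^ r
    ... | yes done = done
    ... | no  more = contradiction D≤ (<⇒≱ (≤-trans (s≤s (m≤m+n (60 * (B * (Q * Q))) (12 * B))) D₀≤D))
      where
      open ≤-Reasoning
      D = r / 3
      q^r≤ : suc Q ^ r ≤ B * (n * n)
      q^r≤ = ≰⇒≥ more
      D₀≤D : D₀ ≤ D
      D₀≤D = subst (_≤ D) (m*n/n≡m D₀ 3) (/-monoˡ-≤ 3 r₀≤r)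
      -- If `n < 2 * L`, then `n ≤ 2 * 2 ^ (r + D)` is so small that the desired bound holds after
      -- all.
      2L≤n : 2 * L ≤ n
      2L≤n = ≮⇒≥ (λ n<2L → more (begin
        B * (n * n)
          ≤⟨ *-monoʳ-≤ B (*-mono-≤ (n≤ n<2L) (n≤ n<2L)) ⟩
        B * (2 * 2 ^ (r + D) * (2 * 2 ^ (r + D)))
          ≡⟨ cong (B *_) (lemma (2 ^ (r + D))) ⟩
        B * (4 * (2 ^ (r + D) * 2 ^ (r + D)))
          ≡⟨ cong (λ t → B * (4 * t)) (square (r + D)) ⟩
        B * (4 * 4 ^ (r + D))
          ≤⟨ 4^[4r/3]-negligible B r (s≤s 6≤Q) (≤-trans (≤-trans (m≤n+m (12 * B) (60 * (B * (Q * Q)))) (n≤1+n _)) D₀≤D) ⟩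
        suc Q ^ r ∎))
        where
        n≤ : n < 2 * L → n ≤ 2 * 2 ^ (r + D)
        n≤ n<2L = ≤-trans (<⇒≤ n<2L) (*-monoʳ-≤ 2 L≤)
        square : ∀ x → 2 ^ x * 2 ^ x ≡ 4 ^ x
        square x = trans (sym (^-distribˡ-+-* 2 x x))
          (trans (cong (λ y → 2 ^ (x + y)) (sym (+-identityʳ x))) (sym (^-*-assoc 2 2 x)))
        lemma : ∀ x → 2 * x * (2 * x) ≡ 4 * (x * x)
        lemma = solve-∀
      n≤2s : n ≤ 2 * s
      n≤2s = +-cancelʳ-≤ n n (2 * s) (begin
        n + n             ≤⟨ +-mono-≤ n≤s+L n≤s+L ⟩
        (s + L) + (s + L) ≡⟨ lemma s L ⟩
        2 * s + 2 * L     ≤⟨ +-monoʳ-≤ (2 * s) 2L≤n ⟩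
        2 * s + n         ∎)
        where
        lemma : ∀ s l → (s + l) + (s + l) ≡ 2 * s + 2 * l
        lemma = solve-∀
      n²≤4K : n * n ≤ 4 * K
      n²≤4K = begin
        n * n       ≤⟨ *-monoʳ-≤ n n≤2s ⟩
        n * (2 * s) ≡⟨ lemma₁ n s ⟩
        2 * (n * s) ≤⟨ *-monoʳ-≤ 2 n*s≤2K ⟩
        2 * (2 * K) ≡⟨ lemma₂ K ⟩
        4 * K       ∎
        where
        lemma₁ : ∀ n s → n * (2 * s) ≡ 2 * (n * s)
        lemma₁ = solve-∀
        lemma₂ : ∀ k → 2 * (2 * k) ≡ 4 * k
        lemma₂ = solve-∀
      instance
        q^r≢0 : NonZero (suc Q ^ r)
        q^r≢0 = m^n≢0 (suc Q) r
        D≢0 : NonZero D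
        D≢0 = >-nonZero (≤-trans (s≤s z≤n) D₀≤D)
      r≤5D : r ≤ 5 * D
      r≤5D = begin
        r             ≡⟨ m≡m%n+[m/n]*n r 3 ⟩
        r % 3 + D * 3 ≤⟨ +-monoˡ-≤ (D * 3) (≤-trans (s≤s⁻¹ (m%n<n r 3)) (m≤m*n 2 D)) ⟩
        2 * D + D * 3 ≡⟨ lemma D ⟩
        5 * D         ∎
        where
        lemma : ∀ d → 2 * d + d * 3 ≡ 5 * d
        lemma = solve-∀
      -- A factor `D` and the power `suc Q ^ r` cancel. The constant is `60 = 4 * 3 * 5`, with 4
      -- from `n²≤4K`, 3 from the variance and 5 from `r≤5D`.
      D≤ : D ≤ 60 * (B * (Q * Q))
      D≤ = *-cancelʳ-≤ D (60 * (B * (Q * Q))) D (*-cancelʳ-≤ (D * D) (60 * (B * (Q * Q)) * D) (suc Q ^ r) (begin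
        D * D * suc Q ^ r                      ≤⟨ *-monoʳ-≤ (D * D) q^r≤ ⟩
        D * D * (B * (n * n))                  ≤⟨ *-monoʳ-≤ (D * D) (*-monoʳ-≤ B n²≤4K) ⟩
        D * D * (B * (4 * K))                  ≡⟨ lemma₁ D B K ⟩
        4 * B * (K * (D * D))                  ≤⟨ *-monoʳ-≤ (4 * B) K≤ ⟩
        4 * B * (3 * (Q * Q) * r * suc Q ^ r)  ≤⟨ *-monoʳ-≤ (4 * B) (*-monoˡ-≤ (suc Q ^ r) (*-monoʳ-≤ (3 * (Q * Q)) r≤5D)) ⟩
        4 * B * (3 * (Q * Q) * (5 * D) * suc Q ^ r) ≡⟨ lemma₂ B Q D (suc Q ^ r) ⟩
        60 * (B * (Q * Q)) * D * suc Q ^ r     ∎))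
        where
        lemma₁ : ∀ d b k → d * d * (b * (4 * k)) ≡ 4 * b * (k * (d * d))
        lemma₁ = solve-∀
        lemma₂ : ∀ b q d p → 4 * b * (3 * (q * q) * (5 * d) * p) ≡ 60 * (b * (q * q)) * d * p
        lemma₂ = solve-∀

-- Linear algebra over a finite field

commutativeRing : Field → CommutativeRing 0ℓ 0ℓ
commutativeRing K = record
  { isCommutativeRing = record
    { isRing = record
      { +-isAbelianGroup = record
        { isGroup = record
          { isMonoid = record
            { isSemigroup = record
              { isMagma = record { isEquivalence = isEquivalence ; ∙-cong = cong₂ _+_ }
              ; assoc = +-assoc }
            ; identity = +-idˡ , λ x → trans (+-comm x 0#) (+-idˡ x) }
          ; inverse = -‿invˡ , λ x → trans (+-comm x (- x)) (-‿invˡ x)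
          ; ⁻¹-cong = cong -_ }
        ; comm = +-comm }
      ; *-cong = cong₂ _*_
      ; *-assoc = *-assoc
      ; *-identity = *-idˡ , λ x → trans (*-comm x 1#) (*-idˡ x)
      ; distrib = distribˡ , λ x y z →
          trans (*-comm (y + z) x) (trans (distribˡ x y z) (cong₂ _+_ (*-comm x y) (*-comm x z))) }
    ; *-comm = *-comm } }
  where open Field K

module LinearAlgebra {q : ℕ} (F : FiniteField q) where
  open Coding F public
  open FiniteField F public using (field′; enumeration; _≟_; inverse; 0≢1)
  open CommutativeRing (commutativeRing field′) public
    hiding (refl; sym; trans; reflexive; isEquivalence; isRing; setoid; _≉_; _≈_; zero)
  open import Algebra.Properties.Semiring.Sum semiring public
    using (sum; sum-cong-≗; ∑-distrib-+; sum-replicate-zero; *-distribˡ-sum; *-distribʳ-sum; ∑-comm)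
  open import Algebra.Properties.Ring ring public using (-‿distribˡ-*; -0#≈0#)
  open import Algebra.Solver.Ring.NaturalCoefficients.Default commutativeSemiring
    using (solve; _:+_; _:*_; _:=_)
  open ≡-Reasoning

  1≢0 : 1# ≢ 0#
  1≢0 = 0≢1 ∘ sym

  infix 8 ⟨_,_⟩
  ⟨_,_⟩ : ∀ {n} → Word n → Word n → Carrier
  ⟨ x , y ⟩ = sum (λ i → x i * y i)

  ⟨⟩-comm : ∀ {n} (x y : Word n) → ⟨ x , y ⟩ ≡ ⟨ y , x ⟩
  ⟨⟩-comm x y = sum-cong-≗ (λ i → *-comm (x i) (y i))

  ⟨⟩-linearʳ : ∀ {n} (b x y : Word n) c →
    ⟨ b , (λ i → x i + c * y i) ⟩ ≡ ⟨ b , x ⟩ + c * ⟨ b , y ⟩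
  ⟨⟩-linearʳ b x y c = begin
    sum (λ i → b i * (x i + c * y i))
      ≡⟨ sum-cong-≗ (λ i → solve 4 (λ b x c y → b :* (x :+ c :* y) := b :* x :+ c :* (b :* y))
                             refl (b i) (x i) c (y i)) ⟩
    sum (λ i → b i * x i + c * (b i * y i))
      ≡⟨ ∑-distrib-+ (λ i → b i * x i) (λ i → c * (b i * y i)) ⟩
    ⟨ b , x ⟩ + sum (λ i → c * (b i * y i))
      ≡⟨ cong (⟨ b , x ⟩ +_) (*-distribˡ-sum c (λ i → b i * y i)) ⟨
    ⟨ b , x ⟩ + c * ⟨ b , y ⟩ ∎

  ⟨⟩-linearˡ : ∀ {n} (b x y : Word n) c →
    ⟨ (λ i → x i + c * y i) , b ⟩ ≡ ⟨ x , b ⟩ + c * ⟨ y , b ⟩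
  ⟨⟩-linearˡ b x y c = begin
    ⟨ (λ i → x i + c * y i) , b ⟩ ≡⟨ ⟨⟩-comm _ b ⟩
    ⟨ b , (λ i → x i + c * y i) ⟩ ≡⟨ ⟨⟩-linearʳ b x y c ⟩
    ⟨ b , x ⟩ + c * ⟨ b , y ⟩     ≡⟨ cong₂ (λ u v → u + c * v) (⟨⟩-comm b x) (⟨⟩-comm b y) ⟩
    ⟨ x , b ⟩ + c * ⟨ y , b ⟩     ∎

  sum-zero : ∀ {n} {f : Word n} → (∀ i → f i ≡ 0#) → sum f ≡ 0#
  sum-zero {n} f≡0 = trans (sum-cong-≗ f≡0) (sum-replicate-zero n)

  sum-single : ∀ {n} (f : Word n) i → (∀ j → j ≢ i → f j ≡ 0#) → sum f ≡ f i
  sum-single f zero    others = begin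
    f zero + sum (f ∘ suc) ≡⟨ cong (f zero +_) (sum-zero (λ j → others (suc j) λ ())) ⟩
    f zero + 0#            ≡⟨ +-identityʳ _ ⟩
    f zero                 ∎
  sum-single f (suc i) others = begin
    f zero + sum (f ∘ suc) ≡⟨ cong₂ _+_ (others zero λ ()) (sum-single (f ∘ suc) i (λ j j≢i → others (suc j) (j≢i ∘ Fin.suc-injective))) ⟩
    0# + f (suc i)         ≡⟨ +-identityˡ _ ⟩
    f (suc i)              ∎

  ⟨⟩-cong : ∀ {n} (x : Word n) {y z : Word n} → (∀ i → y i ≡ z i) → ⟨ x , y ⟩ ≡ ⟨ x , z ⟩
  ⟨⟩-cong x y≗z = sum-cong-≗ (λ i → cong (x i *_) (y≗z i))

  ⟨⟩-scaleʳ : ∀ {n} (x y : Word n) c → ⟨ x , (λ i → y i * c) ⟩ ≡ ⟨ x , y ⟩ * c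
  ⟨⟩-scaleʳ x y c = trans (sum-cong-≗ (λ i → sym (*-assoc (x i) (y i) c))) (sym (*-distribʳ-sum c (λ i → x i * y i)))

  ⟨⟩-+ˡ : ∀ {n} (x y b : Word n) → ⟨ (λ i → x i + y i) , b ⟩ ≡ ⟨ x , b ⟩ + ⟨ y , b ⟩
  ⟨⟩-+ˡ x y b = trans (sum-cong-≗ (λ i → distribʳ (b i) (x i) (y i))) (∑-distrib-+ (λ i → x i * b i) (λ i → y i * b i))

  ⟨⟩-sum : ∀ {n m} (b : Word n) (x : Fin m → Word n) → (∀ k → ⟨ b , x k ⟩ ≡ 0#) →
    ⟨ b , (λ i → sum (λ k → x k i)) ⟩ ≡ 0#
  ⟨⟩-sum b x b⊥x = begin
    sum (λ i → b i * sum (λ k → x k i))   ≡⟨ sum-cong-≗ (λ i → *-distribˡ-sum (b i) (λ k → x k i)) ⟩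
    sum (λ i → sum (λ k → b i * x k i))   ≡⟨ ∑-comm (λ i k → b i * x k i) ⟩
    sum (λ k → ⟨ b , x k ⟩)               ≡⟨ sum-zero b⊥x ⟩
    0#                                    ∎

  single : ∀ {n} → Fin n → Carrier → Word n
  single i c j with j Fin.≟ i
  ... | yes _ = c
  ... | no  _ = 0#

  single-at : ∀ {n} (i : Fin n) c → single i c i ≡ c
  single-at i c with i Fin.≟ i
  ... | yes _   = refl
  ... | no  i≢i = contradiction refl i≢i

  single-off : ∀ {n} {i j : Fin n} c → j ≢ i → single i c j ≡ 0#
  single-off {i = i} {j} c j≢i with j Fin.≟ i
  ... | yes j≡i = contradiction j≡i j≢i
  ... | no  _   = refl

  ⟨⟩-unit : ∀ {n} (y : Word n) k → ⟨ y , single k 1# ⟩ ≡ y k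
  ⟨⟩-unit y k = begin
    ⟨ y , single k 1# ⟩ ≡⟨ sum-single _ k (λ j j≢k → trans (cong (y j *_) (single-off 1# j≢k)) (zeroʳ (y j))) ⟩
    y k * single k 1# k ≡⟨ cong (y k *_) (single-at k 1#) ⟩
    y k * 1#            ≡⟨ *-identityʳ (y k) ⟩
    y k                 ∎

  minus-cancel : ∀ x → - 1# * x + x ≡ 0#
  minus-cancel x = begin
    - 1# * x + x   ≡⟨ cong (_+ x) (-‿distribˡ-* 1# x) ⟨
    - (1# * x) + x ≡⟨ cong (λ t → - t + x) (*-identityˡ x) ⟩
    - x + x        ≡⟨ -‿inverseˡ x ⟩
    0#             ∎

  -1≢0 : - 1# ≢ 0#
  -1≢0 eq = 1≢0 (begin
    1#        ≡⟨ +-identityˡ 1# ⟨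
    0# + 1#   ≡⟨ cong (_+ 1#) eq ⟨
    - 1# + 1# ≡⟨ -‿inverseˡ 1# ⟩
    0#        ∎)

  -- A basis σ of the orthogonal complement of the rows b, in reduced form: on the
  -- coordinates ι the vectors σ form the identity matrix.
  record Annihilator {K n : ℕ} (b : Fin K → Word n) : Set where
    constructor annihilates
    field
      dim   : ℕ
      σ     : Fin dim → Word n
      ι     : Fin dim → Fin n
      large : n ℕ.≤ dim ℕ.+ K
      exact : LinIndep b → dim ℕ.+ K ≡ n
      kills : ∀ j k → ⟨ b j , σ k ⟩ ≡ 0#
      σ-ι   : ∀ k → σ k (ι k) ≡ 1#
      σ-ι′  : ∀ k m → k ≢ m → σ k (ι m) ≡ 0#
      span  : ∀ y → (∀ k → ⟨ y , σ k ⟩ ≡ 0#) → ∃ λ x → ∀ i → lincomb x b i ≡ y i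

  LinIndep-tail : ∀ {K n} {b : Fin (suc K) → Word n} → LinIndep b → LinIndep (b ∘ suc)
  LinIndep-tail {K} {b = b} indep x x·b≡0 j = indep 0∷x (λ i → begin
    0# * b zero i + lincomb x (b ∘ suc) i ≡⟨ cong₂ _+_ (zeroˡ _) (x·b≡0 i) ⟩
    0# + 0#                               ≡⟨ +-identityˡ 0# ⟩
    0#                                    ∎) (suc j)
    where
    0∷x : Fin (suc K) → Carrier
    0∷x zero    = 0#
    0∷x (suc j) = x j

  cons-span : ∀ {K n} {b : Fin (suc K) → Word n} (y : Word n) c x →
    (∀ i → lincomb x (b ∘ suc) i ≡ y i + - c * b zero i) →
    ∃ λ x′ → ∀ i → lincomb x′ b i ≡ y i
  cons-span {K} {b = b} y c x eq = c∷x , λ i → begin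
    c * b zero i + lincomb x (b ∘ suc) i      ≡⟨ cong (c * b zero i +_) (eq i) ⟩
    c * b zero i + (y i + - c * b zero i)     ≡⟨ solve 4 (λ c z y d → c :* z :+ (y :+ d :* z) := (c :+ d) :* z :+ y)
                                                         refl c (b zero i) (y i) (- c) ⟩
    (c + - c) * b zero i + y i                ≡⟨ cong (λ t → t * b zero i + y i) (-‿inverseʳ c) ⟩
    0# * b zero i + y i                       ≡⟨ cong (_+ y i) (zeroˡ (b zero i)) ⟩
    0# + y i                                  ≡⟨ +-identityˡ (y i) ⟩
    y i                                       ∎
    where
    c∷x : Fin (suc K) → Carrier
    c∷x zero    = c
    c∷x (suc j) = x j

  minus-zero : ∀ y z → y + - 0# * z ≡ y
  minus-zero y z = begin
    y + - 0# * z ≡⟨ cong (λ t → y + t * z) -0#≈0# ⟩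
    y + 0# * z   ≡⟨ cong (y +_) (zeroˡ z) ⟩
    y + 0#       ≡⟨ +-identityʳ y ⟩
    y            ∎

  -- Clearing an entry `a` with a pivot `z` whose inverse is `π`.
  eliminate : ∀ a {π z} → π * z ≡ 1# → a + - (a * π) * z ≡ 0#
  eliminate a {π} {z} π*z≡1 = begin
    a + - (a * π) * z   ≡⟨ cong (a +_) (-‿distribˡ-* (a * π) z) ⟨
    a + - (a * π * z)   ≡⟨ cong (λ t → a + - t) (*-assoc a π z) ⟩
    a + - (a * (π * z)) ≡⟨ cong (λ t → a + - (a * t)) π*z≡1 ⟩
    a + - (a * 1#)      ≡⟨ cong (λ t → a + - t) (*-identityʳ a) ⟩
    a + - a             ≡⟨ -‿inverseʳ a ⟩
    0#                  ∎

  -- One step of Gaussian elimination. If some `σ ρ` is not orthogonal to the new row, it is dropped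
  -- after multiples of it have cleared the others; as it vanishes on the remaining coordinates `ι`,
  -- the identity matrix there persists. Otherwise `σ` stays as it is.
  annihilator-suc : ∀ {K n} {b : Fin (suc K) → Word n} → Annihilator (b ∘ suc) → Annihilator b
  annihilator-suc {K} {n} {b} (annihilates s σ ι large exact kills σ-ι σ-ι′ span)
    with any? (λ k → ¬? (⟨ b zero , σ k ⟩ ≟ 0#))
  ... | no no-pivot = annihilates s σ ι
        (ℕ.≤-trans large (ℕ.+-monoʳ-≤ s (ℕ.n≤1+n K)))
        dependent kills′ σ-ι σ-ι′
        (λ y y⊥σ → let x , eq = span y y⊥σ in
          cons-span {b = b} y 0# x (λ i → trans (eq i) (sym (minus-zero (y i) (b zero i)))))
    where
    b₀⊥σ : ∀ k → ⟨ b zero , σ k ⟩ ≡ 0#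
    b₀⊥σ k = decidable-stable (_ ≟ _) (λ ≢0 → no-pivot (k , ≢0))
    kills′ : ∀ j k → ⟨ b j , σ k ⟩ ≡ 0#
    kills′ zero    = b₀⊥σ
    kills′ (suc j) = kills j
    -- By `span` the new row is a combination of the old ones, so independence is contradictory.
    dependent : LinIndep b → s ℕ.+ suc K ≡ n
    dependent indep = contradiction (indep relation vanishes zero) -1≢0
      where
      combo = span (b zero) b₀⊥σ
      relation : Fin (suc K) → Carrier
      relation zero    = - 1#
      relation (suc j) = proj₁ combo j
      vanishes : IsZero (lincomb relation b)
      vanishes i = trans (cong (- 1# * b zero i +_) (proj₂ combo i)) (minus-cancel (b zero i))
  annihilator-suc {K} {n} {b} (annihilates (suc s) σ ι large exact kills σ-ι σ-ι′ span)
      | yes (ρ , zρ≢0) = annihilates s σ′ (ι ∘ punchIn ρ)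
        (ℕ.≤-trans large (ℕ.≤-reflexive (sym (ℕ.+-suc s K))))
        (λ indep → trans (ℕ.+-suc s K) (exact (LinIndep-tail {b = b} indep)))
        kills′ σ′-ι σ′-ι′ span′
    where
    z : Fin (suc s) → Carrier
    z k = ⟨ b zero , σ k ⟩
    π = proj₁ (inverse (z ρ) zρ≢0)
    π*zρ≡1 : π * z ρ ≡ 1#
    π*zρ≡1 = proj₂ (inverse (z ρ) zρ≢0)
    σ′ : Fin s → Word n
    σ′ k i = σ (punchIn ρ k) i + - (z (punchIn ρ k) * π) * σ ρ i
    kills′ : ∀ j k → ⟨ b j , σ′ k ⟩ ≡ 0#
    kills′ zero    k = trans (⟨⟩-linearʳ (b zero) (σ (punchIn ρ k)) (σ ρ) _) (eliminate (z (punchIn ρ k)) π*zρ≡1)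
    kills′ (suc j) k = begin
      ⟨ b (suc j) , σ′ k ⟩ ≡⟨ ⟨⟩-linearʳ (b (suc j)) (σ (punchIn ρ k)) (σ ρ) _ ⟩
      _                    ≡⟨ cong₂ (λ u v → u + _ * v) (kills j (punchIn ρ k)) (kills j ρ) ⟩
      0# + _ * 0#          ≡⟨ trans (+-identityˡ _) (zeroʳ _) ⟩
      0#                   ∎
    off-pivot : ∀ k m → σ′ k (ι (punchIn ρ m)) ≡ σ (punchIn ρ k) (ι (punchIn ρ m))
    off-pivot k m = begin
      v + d * σ ρ (ι (punchIn ρ m)) ≡⟨ cong (λ t → v + d * t) (σ-ι′ ρ (punchIn ρ m) (punchInᵢ≢i ρ m ∘ sym)) ⟩
      v + d * 0#                    ≡⟨ cong (v +_) (zeroʳ d) ⟩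
      v + 0#                        ≡⟨ +-identityʳ v ⟩
      v                             ∎
      where
      v = σ (punchIn ρ k) (ι (punchIn ρ m))
      d = - (z (punchIn ρ k) * π)
    σ′-ι : ∀ k → σ′ k (ι (punchIn ρ k)) ≡ 1#
    σ′-ι k = trans (off-pivot k k) (σ-ι (punchIn ρ k))
    σ′-ι′ : ∀ k m → k ≢ m → σ′ k (ι (punchIn ρ m)) ≡ 0#
    σ′-ι′ k m k≢m = trans (off-pivot k m) (σ-ι′ _ _ (k≢m ∘ punchIn-injective ρ k m))
    span′ : ∀ y → (∀ k → ⟨ y , σ′ k ⟩ ≡ 0#) → ∃ λ x → ∀ i → lincomb x b i ≡ y i
    span′ y y⊥σ′ = let x , eq = span y′ y′⊥σ in cons-span {b = b} y c x eq
      where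
      -- With this `c` the vector `y′` is orthogonal to the dropped `σ ρ`. For the other vectors
      -- `swap` moves the correction from `y` to `σ`, turning `⟨ y′ , σ m′ ⟩` into `⟨ y , σ′ m ⟩`.
      c = ⟨ y , σ ρ ⟩ * π
      y′ : Word n
      y′ i = y i + - c * b zero i
      swap : ∀ u v → - (u * π) * v ≡ - (v * π) * u
      swap u v = begin
        - (u * π) * v ≡⟨ -‿distribˡ-* (u * π) v ⟨
        - (u * π * v) ≡⟨ cong -_ (solve 3 (λ u p v → u :* p :* v := v :* p :* u) refl u π v) ⟩
        - (v * π * u) ≡⟨ -‿distribˡ-* (v * π) u ⟩
        - (v * π) * u ∎
      y′⊥σ : ∀ k → ⟨ y′ , σ k ⟩ ≡ 0#
      y′⊥σ k with ρ Fin.≟ k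
      ... | yes refl = trans (⟨⟩-linearˡ (σ ρ) y (b zero) (- c)) (eliminate ⟨ y , σ ρ ⟩ π*zρ≡1)
      ... | no ρ≢k = subst (λ k → ⟨ y′ , σ k ⟩ ≡ 0#) (Fin.punchIn-punchOut ρ≢k) (at-punchIn _)
        where
        at-punchIn : ∀ m → ⟨ y′ , σ (punchIn ρ m) ⟩ ≡ 0#
        at-punchIn m = begin
          ⟨ y′ , σ m′ ⟩                            ≡⟨ ⟨⟩-linearˡ (σ m′) y (b zero) (- c) ⟩
          ⟨ y , σ m′ ⟩ + - c * z m′                ≡⟨ cong (⟨ y , σ m′ ⟩ +_) (swap ⟨ y , σ ρ ⟩ (z m′)) ⟩
          ⟨ y , σ m′ ⟩ + - (z m′ * π) * ⟨ y , σ ρ ⟩ ≡⟨ ⟨⟩-linearʳ y (σ m′) (σ ρ) _ ⟨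
          ⟨ y , σ′ m ⟩                             ≡⟨ y⊥σ′ m ⟩
          0#                                       ∎
          where m′ = punchIn ρ m

  -- Without rows the standard basis serves. For a generator matrix the result is a parity check
  -- matrix; for the values of monomials it supplies weights that kill them.
  annihilator : ∀ {K n} (b : Fin K → Word n) → Annihilator b
  annihilator {zero} {n} b = annihilates n (λ k → single k 1#) (λ k → k)
    (ℕ.≤-reflexive (sym (ℕ.+-identityʳ n))) (λ _ → ℕ.+-identityʳ n) (λ ())
    (λ k → single-at k 1#) (λ k m k≢m → single-off 1# (k≢m ∘ sym))
    (λ y y⊥ → (λ ()) , λ i → trans (sym (y⊥ i)) (⟨⟩-unit y i))
  annihilator {suc K} b = annihilator-suc {b = b} (annihilator (b ∘ suc))

-- The indicator function of 0 as a polynomial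

module Polynomials {q : ℕ} (F : FiniteField q) where
  open LinearAlgebra F
  open Counting using (degree)
  open import Algebra.Properties.Semiring.Exp semiring using (_^_)
  open import Algebra.Solver.Ring.NaturalCoefficients.Default commutativeSemiring
    using (solve; con; _:+_; _:*_; _:=_)
  open ≡-Reasoning

  -- factors units z = ∏ (1 + s z) over all s ≠ 0, the indicator function of z = 0.
  factors : List Carrier → Carrier → Carrier
  factors []       z = 1#
  factors (s ∷ ss) z = (1# + s * z) * factors ss z

  factors-0 : ∀ ss → factors ss 0# ≡ 1#
  factors-0 []       = refl
  factors-0 (s ∷ ss) = begin
    (1# + s * 0#) * factors ss 0# ≡⟨ cong₂ (λ u v → (1# + u) * v) (zeroʳ s) (factors-0 ss) ⟩
    (1# + 0#) * 1#                ≡⟨ trans (*-identityʳ _) (+-identityʳ _) ⟩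
    1#                            ∎

  factors-root : ∀ {ss s} z → s ∈ ss → 1# + s * z ≡ 0# → factors ss z ≡ 0#
  factors-root {_ ∷ ss} z (here refl) root = trans (cong (_* factors ss z) root) (zeroˡ _)
  factors-root {s ∷ _}  z (there s∈)  root = trans (cong ((1# + s * z) *_) (factors-root z s∈ root)) (zeroʳ _)

  units : List Carrier
  units = List.filter (λ x → ¬? (x ≟ 0#)) (List.map (Inverse.to enumeration) (List.allFin q))

  ∈-elements : ∀ x → x ∈ List.map (Inverse.to enumeration) (List.allFin q)
  ∈-elements x = subst (_∈ _) (Inverse.strictlyInverseˡ enumeration x)
    (∈-map⁺ (Inverse.to enumeration) (∈-allFin (Inverse.from enumeration x)))

  ∈-units : ∀ {x} → x ≢ 0# → x ∈ units
  ∈-units {x} x≢0 = ∈-filter⁺ (λ x → ¬? (x ≟ 0#)) (∈-elements x) x≢0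

  -- The filter drops `0#`, so the indicator function has degree at most `q - 1` in each coordinate.
  length-units : length units ℕ.< q
  length-units = subst (length units ℕ.<_)
    (trans (length-map (Inverse.to enumeration) (List.allFin q)) (length-tabulate (λ i → i)))
    (filter-notAll (λ x → ¬? (x ≟ 0#)) _ (Any.map (λ 0≡x x≢0 → x≢0 (sym 0≡x)) (∈-elements 0#)))

  -- The factor for `s = - z⁻¹` vanishes.
  factors-units : ∀ {z} → z ≢ 0# → factors units z ≡ 0#
  factors-units {z} z≢0 = factors-root z (∈-units s≢0) root
    where
    s = - proj₁ (inverse z z≢0)
    s*z≡-1 : s * z ≡ - 1#
    s*z≡-1 = trans (sym (-‿distribˡ-* _ z)) (cong -_ (proj₂ (inverse z z≢0)))
    s≢0 : s ≢ 0#
    s≢0 s≡0 = -1≢0 (trans (sym s*z≡-1) (trans (cong (_* z) s≡0) (zeroˡ z)))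
    root : 1# + s * z ≡ 0#
    root = trans (cong (1# +_) s*z≡-1) (-‿inverseʳ 1#)

  -- The indicator function of the zero vector.
  Δ : ∀ {r} → Word r → Carrier
  Δ {zero}  z = 1#
  Δ {suc r} z = factors units (z zero) * Δ (z ∘ suc)

  Δ-zero : ∀ {r} {z : Word r} → IsZero z → Δ z ≡ 1#
  Δ-zero {zero}  z≡0 = refl
  Δ-zero {suc r} z≡0 = trans (cong₂ (λ u v → factors units u * v) (z≡0 zero) (Δ-zero (z≡0 ∘ suc)))
    (trans (*-identityʳ _) (factors-0 units))

  Δ-nonzero : ∀ {r} (z : Word r) i → z i ≢ 0# → Δ z ≡ 0#
  Δ-nonzero z zero    zi≢0 = trans (cong (_* Δ (z ∘ suc)) (factors-units zi≢0)) (zeroˡ _)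
  Δ-nonzero z (suc i) zi≢0 = trans (cong (factors units (z zero) *_) (Δ-nonzero (z ∘ suc) i zi≢0)) (zeroʳ _)

  monomial : ∀ {r} → Vec ℕ r → Word r → Carrier
  monomial []      u = 1#
  monomial (a ∷ e) u = u zero ^ a * monomial e (u ∘ suc)

  -- Null is to be the kernel of a linear functional.  Multiplying the factors out
  -- inside Null avoids any representation of polynomials by coefficients.
  module Expansion {X : Set} (Null : (X → Carrier) → Set)
    (respects : ∀ {f g} → (∀ x → f x ≡ g x) → Null f → Null g)
    (linear : ∀ {f g} c → Null f → Null g → Null (λ x → f x + c * g x))
    where

    -- Each factor `1 + s * (U + W + Y)` joins the weight `ψ`, where it splits into four terms that
    -- raise the total exponent by at most one.
    factors-null : ∀ ss (ψ U W Y : X → Carrier) →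
      (∀ a b c → a ℕ.+ b ℕ.+ c ℕ.≤ length ss → Null (λ x → ψ x * (U x ^ a * (W x ^ b * Y x ^ c)))) →
      Null (λ x → ψ x * factors ss (U x + W x + Y x))
    factors-null [] ψ U W Y null = respects (λ x → cong (ψ x *_) (trans (*-identityˡ _) (*-identityˡ _))) (null 0 0 0 z≤n)
    factors-null (s ∷ ss) ψ U W Y null =
      respects (λ x → *-assoc (ψ x) _ _)
        (factors-null ss (λ x → ψ x * (1# + s * (U x + W x + Y x))) U W Y step)
      where
      step : ∀ a b c → a ℕ.+ b ℕ.+ c ℕ.≤ length ss →
        Null (λ x → ψ x * (1# + s * (U x + W x + Y x)) * (U x ^ a * (W x ^ b * Y x ^ c)))
      step a b c a+b+c≤ = respects
        (λ x → solve 8 (λ p s u w y m n k →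
            p :* (m :* (n :* k)) :+ s :* (p :* ((u :* m) :* (n :* k))) :+ s :* (p :* (m :* ((w :* n) :* k))) :+ s :* (p :* (m :* (n :* (y :* k))))
            := p :* (con 1 :+ s :* (u :+ w :+ y)) :* (m :* (n :* k)))
          refl (ψ x) s (U x) (W x) (Y x) (U x ^ a) (W x ^ b) (Y x ^ c))
        (linear s (linear s (linear s
          (null a b c (ℕ.m≤n⇒m≤1+n a+b+c≤))
          (null (suc a) b c (s≤s a+b+c≤)))
          (null a (suc b) c (subst (λ t → t ℕ.+ c ℕ.≤ suc (length ss)) (sym (ℕ.+-suc a b)) (s≤s a+b+c≤))))
          (null a b (suc c) (subst (ℕ._≤ suc (length ss)) (sym (ℕ.+-suc (a ℕ.+ b) c)) (s≤s a+b+c≤))))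

    -- Induction on the coordinates: the first is expanded with the rest of `Δ` in the weight, and
    -- the resulting monomial joins `φ` while the others are expanded. Each coordinate adds at most
    -- `Q` to the total degree.
    Δ-null : ∀ {r Q} → length units ℕ.≤ Q → (φ : X → Carrier) (U W Y : X → Word r) →
      (∀ e f h → All (ℕ._≤ Q) e → All (ℕ._≤ Q) f → degree e ℕ.+ degree f ℕ.+ degree h ℕ.≤ Q ℕ.* r →
        Null (λ x → φ x * (monomial e (U x) * (monomial f (W x) * monomial h (Y x))))) →
      Null (λ x → φ x * Δ (λ i → U x i + W x i + Y x i))
    Δ-null {zero} units≤Q φ U W Y null =
      respects (λ x → cong (φ x *_) (trans (*-identityˡ _) (*-identityˡ _))) (null [] [] [] [] [] z≤n)
    Δ-null {suc r} {Q} units≤Q φ U W Y null =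
      respects (λ x → solve 3 (λ p d f → p :* d :* f := p :* (f :* d)) refl (φ x) (rest x) _)
        (factors-null units (λ x → φ x * rest x) (λ x → U x zero) (λ x → W x zero) (λ x → Y x zero) step)
      where
      rest : X → Carrier
      rest x = Δ (λ i → U x (suc i) + W x (suc i) + Y x (suc i))
      step : ∀ a b c → a ℕ.+ b ℕ.+ c ℕ.≤ length units →
        Null (λ x → φ x * rest x * (U x zero ^ a * (W x zero ^ b * Y x zero ^ c)))
      step a b c a+b+c≤ =
        respects (λ x → solve 3 (λ p d m → p :* m :* d := p :* d :* m) refl (φ x) (rest x) _)
          (Δ-null units≤Q (λ x → φ x * (U x zero ^ a * (W x zero ^ b * Y x zero ^ c)))
            (λ x → U x ∘ suc) (λ x → W x ∘ suc) (λ x → Y x ∘ suc) tails)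
        where
        sum≤Q = ℕ.≤-trans a+b+c≤ units≤Q
        a+b≤Q = ℕ.≤-trans (ℕ.m≤m+n (a ℕ.+ b) c) sum≤Q
        tails : ∀ e f h → All (ℕ._≤ Q) e → All (ℕ._≤ Q) f → degree e ℕ.+ degree f ℕ.+ degree h ℕ.≤ Q ℕ.* r →
          Null (λ x → φ x * (U x zero ^ a * (W x zero ^ b * Y x zero ^ c)) *
            (monomial e (U x ∘ suc) * (monomial f (W x ∘ suc) * monomial h (Y x ∘ suc))))
        tails e f h e≤Q f≤Q degree≤ = respects
          (λ x → solve 7 (λ p m n k m′ n′ k′ → p :* ((m :* m′) :* ((n :* n′) :* (k :* k′))) := p :* (m :* (n :* k)) :* (m′ :* (n′ :* k′)))
            refl (φ x) (U x zero ^ a) (W x zero ^ b) (Y x zero ^ c)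
              (monomial e (U x ∘ suc)) (monomial f (W x ∘ suc)) (monomial h (Y x ∘ suc)))
          (null (a ∷ e) (b ∷ f) (c ∷ h)
            (ℕ.≤-trans (ℕ.m≤m+n a b) a+b≤Q ∷ e≤Q) (ℕ.≤-trans (ℕ.m≤n+m b a) a+b≤Q ∷ f≤Q)
            (subst₂ ℕ._≤_ (regroup a b c (degree e) (degree f) (degree h)) (sym (ℕ.*-suc Q r)) (ℕ.+-mono-≤ sum≤Q degree≤)))
          where
          regroup : ∀ a b c d e f → (a ℕ.+ b ℕ.+ c) ℕ.+ (d ℕ.+ e ℕ.+ f) ≡ (a ℕ.+ d) ℕ.+ (b ℕ.+ e) ℕ.+ (c ℕ.+ f)
          regroup = solve-∀

  module _ {m n o} (t : Word m) (v : Word n) (g : Word o) where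

    trilinear : (Fin m × Fin n × Fin o → Carrier) → Carrier
    trilinear f = ⟨ t , (λ k → ⟨ v , (λ p → ⟨ g , (λ l → f (k , p , l)) ⟩) ⟩) ⟩

    trilinear-cong : ∀ {f f′} → (∀ x → f x ≡ f′ x) → trilinear f ≡ trilinear f′
    trilinear-cong f≗f′ = ⟨⟩-cong t (λ k → ⟨⟩-cong v (λ p → ⟨⟩-cong g (λ l → f≗f′ (k , p , l))))

    trilinear-linear : ∀ f f′ c → trilinear (λ x → f x + c * f′ x) ≡ trilinear f + c * trilinear f′
    trilinear-linear f f′ c = trans
      (⟨⟩-cong t (λ k → trans (⟨⟩-cong v (λ p → ⟨⟩-linearʳ g _ _ c)) (⟨⟩-linearʳ v _ _ c)))
      (⟨⟩-linearʳ t _ _ c)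

    -- This allows a monomial to be killed through any one of its three factors.
    trilinear-product : ∀ (A : Word n) (B : Word m) (C : Word o) →
      trilinear (λ (k , p , l) → A p * (B k * C l)) ≡ ⟨ v , A ⟩ * (⟨ t , B ⟩ * ⟨ g , C ⟩)
    trilinear-product A B C = begin
      ⟨ t , (λ k → ⟨ v , (λ p → ⟨ g , (λ l → A p * (B k * C l)) ⟩) ⟩) ⟩
        ≡⟨ ⟨⟩-cong t (λ k → trans (⟨⟩-cong v (inner k)) (⟨⟩-scaleʳ v A (B k * ⟨ g , C ⟩))) ⟩
      ⟨ t , (λ k → ⟨ v , A ⟩ * (B k * ⟨ g , C ⟩)) ⟩
        ≡⟨ ⟨⟩-cong t (λ k → rotate ⟨ v , A ⟩ (B k) ⟨ g , C ⟩) ⟩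
      ⟨ t , (λ k → B k * (⟨ v , A ⟩ * ⟨ g , C ⟩)) ⟩
        ≡⟨ ⟨⟩-scaleʳ t B _ ⟩
      ⟨ t , B ⟩ * (⟨ v , A ⟩ * ⟨ g , C ⟩)
        ≡⟨ rotate ⟨ v , A ⟩ ⟨ t , B ⟩ ⟨ g , C ⟩ ⟨
      ⟨ v , A ⟩ * (⟨ t , B ⟩ * ⟨ g , C ⟩) ∎
      where
      rotate : ∀ a b c → a * (b * c) ≡ b * (a * c)
      rotate = solve 3 (λ a b c → a :* (b :* c) := b :* (a :* c)) refl
      inner : ∀ k p → ⟨ g , (λ l → A p * (B k * C l)) ⟩ ≡ A p * (B k * ⟨ g , C ⟩)
      inner k p = begin
        ⟨ g , (λ l → A p * (B k * C l)) ⟩ ≡⟨ ⟨⟩-cong g (λ l → solve 3 (λ a b c → a :* (b :* c) := c :* (a :* b)) refl (A p) (B k) (C l)) ⟩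
        ⟨ g , (λ l → C l * (A p * B k)) ⟩ ≡⟨ ⟨⟩-scaleʳ g C _ ⟩
        ⟨ g , C ⟩ * (A p * B k)           ≡⟨ solve 3 (λ a b c → c :* (a :* b) := a :* (b :* c)) refl (A p) (B k) ⟨ g , C ⟩ ⟩
        A p * (B k * ⟨ g , C ⟩)           ∎

-- Relations of weight at most five

module Weights {q : ℕ} (F : FiniteField q) where
  open LinearAlgebra F
  open import Algebra.Properties.Group +-group using (inverseʳ-unique)
  open import Algebra.Solver.Ring.NaturalCoefficients.Default commutativeSemiring
    using (solve; con; _:+_; _:*_; _:=_)
  open ≡-Reasoning

  wt-cong : ∀ {n} {x y : Word n} → (∀ i → x i ≡ y i) → wt x ≡ wt y
  wt-cong {zero}  x≗y = refl
  wt-cong {suc n} {x} {y} x≗y with x zero ≟ 0# | y zero ≟ 0#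
  ... | yes _   | yes _   = wt-cong (x≗y ∘ suc)
  ... | no  _   | no  _   = cong suc (wt-cong (x≗y ∘ suc))
  ... | yes x≡0 | no  y≢0 = contradiction (trans (sym (x≗y zero)) x≡0) y≢0
  ... | no  x≢0 | yes y≡0 = contradiction (trans (x≗y zero) y≡0) x≢0

  wt-+ : ∀ {n} (x y : Word n) → wt (λ i → x i + y i) ℕ.≤ wt x ℕ.+ wt y
  wt-+ {zero}  x y = z≤n
  wt-+ {suc n} x y with (x zero + y zero) ≟ 0# | x zero ≟ 0# | y zero ≟ 0#
  ... | yes _    | yes _   | yes _   = wt-+ (x ∘ suc) (y ∘ suc)
  ... | yes _    | yes _   | no  _   = ℕ.≤-trans (wt-+ (x ∘ suc) (y ∘ suc)) (ℕ.+-monoʳ-≤ _ (ℕ.n≤1+n _))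
  ... | yes _    | no  _   | yes _   = ℕ.m≤n⇒m≤1+n (wt-+ (x ∘ suc) (y ∘ suc))
  ... | yes _    | no  _   | no  _   = ℕ.m≤n⇒m≤1+n (ℕ.≤-trans (wt-+ (x ∘ suc) (y ∘ suc)) (ℕ.+-monoʳ-≤ _ (ℕ.n≤1+n _)))
  ... | no x+y≢0 | yes x≡0 | yes y≡0 = contradiction (trans (cong₂ _+_ x≡0 y≡0) (+-identityˡ 0#)) x+y≢0
  ... | no _     | yes _   | no  _   = ℕ.≤-trans (s≤s (wt-+ (x ∘ suc) (y ∘ suc))) (ℕ.≤-reflexive (sym (ℕ.+-suc _ _)))
  ... | no _     | no  _   | yes _   = s≤s (wt-+ (x ∘ suc) (y ∘ suc))
  ... | no _     | no  _   | no  _   = s≤s (ℕ.≤-trans (wt-+ (x ∘ suc) (y ∘ suc)) (ℕ.+-monoʳ-≤ _ (ℕ.n≤1+n _)))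

  wt-zero : ∀ {n} {x : Word n} → IsZero x → wt x ≡ 0
  wt-zero {zero}  x≡0 = refl
  wt-zero {suc n} {x} x≡0 with x zero ≟ 0#
  ... | yes _   = wt-zero (x≡0 ∘ suc)
  ... | no  x≢0 = contradiction (x≡0 zero) x≢0

  wt-single : ∀ {n} (i : Fin n) c → wt (single i c) ℕ.≤ 1
  wt-single {suc n} zero c with c ≟ 0#
  ... | yes _ = ℕ.m≤n⇒m≤1+n (ℕ.≤-reflexive (wt-zero {n} (λ _ → refl)))
  ... | no  _ = s≤s (ℕ.≤-reflexive (wt-zero {n} (λ _ → refl)))
  wt-single {suc n} (suc i) c with 0# ≟ 0#
  ... | yes _   = subst (ℕ._≤ 1) (wt-cong {x = single i c} shift) (wt-single i c)
    where
    shift : ∀ j → single i c j ≡ single (suc i) c (suc j)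
    shift j with j Fin.≟ i
    ... | yes _ = refl
    ... | no  _ = refl
  ... | no 0≢0 = contradiction refl 0≢0

  single-cases : ∀ {n} (i j : Fin n) c → (j ≡ i × single i c j ≡ c) ⊎ (j ≢ i × single i c j ≡ 0#)
  single-cases i j c with j Fin.≟ i
  ... | yes j≡i = inj₁ (j≡i , refl)
  ... | no  j≢i = inj₂ (j≢i , refl)

  -- Pigeonhole: if `xs` covered the field, positions in `xs` would embed `Fin q` into
  -- `Fin (length xs)`.
  avoid : (xs : List Carrier) → length xs ℕ.< q → ∃ λ x → x ∉ xs
  avoid xs xs<q with any? (λ i → ¬? (Inverse.to enumeration i ∈? xs))
    where open DecMembership _≟_ using (_∈?_)
  ... | yes (i , i∉xs) = Inverse.to enumeration i , i∉xs
  ... | no  covered    = contradiction (injective⇒≤ {f = λ i → Any.index (to∈ i)} index-injective) (ℕ.<⇒≱ xs<q)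
    where
    open DecMembership _≟_ using (_∈?_)
    to∈ : ∀ i → Inverse.to enumeration i ∈ xs
    to∈ i = decidable-stable (_ ∈? xs) (λ ∉xs → covered (i , ∉xs))
    index-injective : ∀ {i j} → Any.index (to∈ i) ≡ Any.index (to∈ j) → i ≡ j
    index-injective {i} {j} eq = begin
      i                                                     ≡⟨ Inverse.strictlyInverseʳ enumeration i ⟨
      Inverse.from enumeration (Inverse.to enumeration i)   ≡⟨ cong (Inverse.from enumeration) (lookup-index (to∈ i)) ⟩
      Inverse.from enumeration (lookup xs (Any.index (to∈ i))) ≡⟨ cong (Inverse.from enumeration ∘ lookup xs) eq ⟩
      Inverse.from enumeration (lookup xs (Any.index (to∈ j))) ≡⟨ cong (Inverse.from enumeration) (lookup-index (to∈ j)) ⟨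
      Inverse.from enumeration (Inverse.to enumeration j)   ≡⟨ Inverse.strictlyInverseʳ enumeration j ⟩
      j                                                     ∎

  signs : List Carrier
  signs = 0# ∷ 1# ∷ - 1# ∷ []

  -- With `γ = - (α + β)` the exclusions say that no partial sum of `α`, `β`, `γ` equals `- 1#` and
  -- that only the empty and the full one vanish.
  record Coefficients : Set where
    field
      α β   : Carrier
      α∉    : α ∉ signs
      β∉    : β ∉ signs
      α+β∉  : α + β ∉ signs

  coefficients : 7 ℕ.≤ q → Coefficients
  coefficients 7≤q = record
    { α = α ; β = β ; α∉ = α∉ ; β∉ = β∉ ∘ ∈-++⁺ˡ
    ; α+β∉ = λ α+β∈ → β∉ (∈-++⁺ʳ signs (subst (_∈ List.map (λ x → - α + x) signs) shift (∈-map⁺ (λ x → - α + x) α+β∈))) }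
    where
    α,∉ = avoid signs (ℕ.≤-trans (ℕ.m≤m+n 4 3) 7≤q)
    α   = proj₁ α,∉
    α∉  = proj₂ α,∉
    -- Three values are forbidden for `β` and three for `α + β`, six in all, whence `7 ≤ q`.
    β,∉ = avoid (signs List.++ List.map (λ x → - α + x) signs) 7≤q
    β   = proj₁ β,∉
    β∉  = proj₂ β,∉
    shift : - α + (α + β) ≡ β
    shift = begin
      - α + (α + β) ≡⟨ +-assoc (- α) α β ⟨
      - α + α + β   ≡⟨ cong (_+ β) (-‿inverseˡ α) ⟩
      0# + β        ≡⟨ +-identityˡ β ⟩
      β             ∎

  module Relation (C : Coefficients) where
    open Coefficients C

    γ : Carrier
    γ = - (α + β)

    -- The relation is split by row pair, column pair and summation index, so that its syndrome is a
    -- sum of three terms in separate variables.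
    U W : ∀ {n} → Fin n → Fin n → Word n
    U i j m = single i 1# m + single j α m
    W i j m = single i (- 1#) m + single j β m

    Y : ∀ {n} → Fin n → Word n
    Y l = single l γ

    relation : ∀ {n} (i j i′ j′ l : Fin n) → Word n
    relation i j i′ j′ l m = U i j m + W i′ j′ m + Y l m

    wt-relation : ∀ {n} (i j i′ j′ l : Fin n) → wt (relation i j i′ j′ l) ℕ.≤ 5
    wt-relation i j i′ j′ l =
      ℕ.≤-trans (wt-+ (λ m → U i j m + W i′ j′ m) (Y l)) (ℕ.+-mono-≤
        (ℕ.≤-trans (wt-+ (U i j) (W i′ j′)) (ℕ.+-mono-≤ (two i j 1# α) (two i′ j′ (- 1#) β)))
        (wt-single l γ))
      where
      two : ∀ {n} (i j : Fin n) c d → wt (λ m → single i c m + single j d m) ℕ.≤ 2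
      two i j c d = ℕ.≤-trans (wt-+ (single i c) (single j d)) (ℕ.+-mono-≤ (wt-single i c) (wt-single j d))

    α+β+γ≡0 : α + β + γ ≡ 0#
    α+β+γ≡0 = -‿inverseʳ (α + β)

    single-cancel : ∀ {n} (i m : Fin n) → single i 1# m + single i (- 1#) m ≡ 0#
    single-cancel i m with m Fin.≟ i
    ... | yes _ = -‿inverseʳ 1#
    ... | no  _ = +-identityˡ 0#

    relation-diagonal : ∀ {n} (i j : Fin n) → IsZero (relation i j i j j)
    relation-diagonal i j m = begin
      (single i 1# m + single j α m) + (single i (- 1#) m + single j β m) + single j γ m
        ≡⟨ solve 5 (λ a b c d e → (a :+ b) :+ (c :+ d) :+ e := (a :+ c) :+ ((b :+ d) :+ e)) refl
             (single i 1# m) (single j α m) (single i (- 1#) m) (single j β m) (single j γ m) ⟩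
      (single i 1# m + single i (- 1#) m) + ((single j α m + single j β m) + single j γ m)
        ≡⟨ cong₂ _+_ (single-cancel i m) at-j ⟩
      0# + 0# ≡⟨ +-identityˡ 0# ⟩
      0# ∎
      where
      at-j : (single j α m + single j β m) + single j γ m ≡ 0#
      at-j with m Fin.≟ j
      ... | yes _ = α+β+γ≡0
      ... | no  _ = trans (+-identityʳ _) (+-identityˡ 0#)

    -- The cases are the eight partial sums of `α`, `β`, `γ`. As `α + β + γ` is zero, a sum
    -- containing `γ` is minus its complement; the empty and the full sum would give `1# ≡ 0#`.
    no-cancellation : ∀ {a b c} → a ≡ α ⊎ a ≡ 0# → b ≡ β ⊎ b ≡ 0# → c ≡ γ ⊎ c ≡ 0# → 1# + (a + b + c) ≢ 0#
    no-cancellation (inj₁ refl) (inj₁ refl) (inj₁ refl) eq = 1≢0 (begin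
      1#                  ≡⟨ +-identityʳ 1# ⟨
      1# + 0#             ≡⟨ cong (1# +_) α+β+γ≡0 ⟨
      1# + (α + β + γ)    ≡⟨ eq ⟩
      0#                  ∎)
    no-cancellation (inj₁ refl) (inj₁ refl) (inj₂ refl) eq = α+β∉ (there (there (here
      (trans (sym (+-identityʳ _)) (inverseʳ-unique 1# _ eq)))))
    no-cancellation (inj₁ refl) (inj₂ refl) (inj₁ refl) eq = β∉ (there (here (begin
      β                            ≡⟨ +-identityˡ β ⟨
      0# + β                       ≡⟨ cong (_+ β) eq ⟨
      1# + (α + 0# + γ) + β        ≡⟨ solve 3 (λ a b c → con 1 :+ (a :+ con 0 :+ c) :+ b := con 1 :+ (a :+ b :+ c)) refl α β γ ⟩
      1# + (α + β + γ)             ≡⟨ cong (1# +_) α+β+γ≡0 ⟩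
      1# + 0#                      ≡⟨ +-identityʳ 1# ⟩
      1#                           ∎)))
    no-cancellation (inj₁ refl) (inj₂ refl) (inj₂ refl) eq = α∉ (there (there (here
      (trans (sym (trans (+-identityʳ _) (+-identityʳ α))) (inverseʳ-unique 1# _ eq)))))
    no-cancellation (inj₂ refl) (inj₁ refl) (inj₁ refl) eq = α∉ (there (here (begin
      α                            ≡⟨ +-identityˡ α ⟨
      0# + α                       ≡⟨ cong (_+ α) eq ⟨
      1# + (0# + β + γ) + α        ≡⟨ solve 3 (λ a b c → con 1 :+ (con 0 :+ b :+ c) :+ a := con 1 :+ (a :+ b :+ c)) refl α β γ ⟩
      1# + (α + β + γ)             ≡⟨ cong (1# +_) α+β+γ≡0 ⟩
      1# + 0#                      ≡⟨ +-identityʳ 1# ⟩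
      1#                           ∎)))
    no-cancellation (inj₂ refl) (inj₁ refl) (inj₂ refl) eq = β∉ (there (there (here
      (trans (sym (trans (+-identityʳ _) (+-identityˡ β))) (inverseʳ-unique 1# _ eq)))))
    no-cancellation (inj₂ refl) (inj₂ refl) (inj₁ refl) eq = α+β∉ (there (here (begin
      α + β                        ≡⟨ +-identityˡ (α + β) ⟨
      0# + (α + β)                 ≡⟨ cong (_+ (α + β)) eq ⟨
      1# + (0# + 0# + γ) + (α + β) ≡⟨ solve 3 (λ a b c → con 1 :+ (con 0 :+ con 0 :+ c) :+ (a :+ b) := con 1 :+ (a :+ b :+ c)) refl α β γ ⟩
      1# + (α + β + γ)             ≡⟨ cong (1# +_) α+β+γ≡0 ⟩
      1# + 0#                      ≡⟨ +-identityʳ 1# ⟩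
      1#                           ∎)))
    no-cancellation (inj₂ refl) (inj₂ refl) (inj₂ refl) eq = 1≢0 (begin
      1#                  ≡⟨ solve 0 (con 1 := con 1 :+ (con 0 :+ con 0 :+ con 0)) refl ⟩
      1# + (0# + 0# + 0#) ≡⟨ eq ⟩
      0#                  ∎)

    value : ∀ {n} (i j : Fin n) c → single i c j ≡ c ⊎ single i c j ≡ 0#
    value i j c with single-cases i j c
    ... | inj₁ (_ , eq) = inj₁ eq
    ... | inj₂ (_ , eq) = inj₂ eq

    -- If `i ≢ i′`, the entry at `i` is `1#` plus a partial sum of `α`, `β`, `γ`, whatever other
    -- indices coincide with `i`. If `i ≡ i′`, then `1#` and `- 1#` cancel, and the entry at `j` is
    -- a partial sum containing `α`, which vanishes only when it is the full one.
    relation-trivial : ∀ {n} (i j i′ j′ l : Fin n) → IsZero (relation i j i′ j′ l) → i ≡ i′ × j ≡ j′ × j ≡ l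
    relation-trivial i j i′ j′ l zero-relation with i Fin.≟ i′
    ... | no i≢i′ = contradiction
          (begin
            1# + (single j α i + single j′ β i + single l γ i)
              ≡⟨ solve 3 (λ a b c → con 1 :+ (a :+ b :+ c) := (con 1 :+ a) :+ (con 0 :+ b) :+ c) refl
                   (single j α i) (single j′ β i) (single l γ i) ⟩
            (1# + single j α i) + (0# + single j′ β i) + single l γ i
              ≡⟨ cong₂ (λ u v → (u + single j α i) + (v + single j′ β i) + single l γ i)
                   (sym (single-at i 1#)) (sym (single-off (- 1#) i≢i′)) ⟩
            relation i j i′ j′ l i ≡⟨ zero-relation i ⟩
            0# ∎)
          (no-cancellation (value j i α) (value j′ i β) (value l i γ))
    ... | yes refl = refl , rest (single-cases j′ j β) (single-cases l j γ)
      where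
      at-j : α + single j′ β j + single l γ j ≡ 0#
      at-j = begin
        α + single j′ β j + single l γ j
          ≡⟨ cong (λ t → t + single j′ β j + single l γ j) (single-at j α) ⟨
        single j α j + single j′ β j + single l γ j
          ≡⟨ +-identityˡ _ ⟨
        0# + (single j α j + single j′ β j + single l γ j)
          ≡⟨ cong (_+ (single j α j + single j′ β j + single l γ j)) (single-cancel i j) ⟨
        (single i 1# j + single i (- 1#) j) + (single j α j + single j′ β j + single l γ j)
          ≡⟨ solve 5 (λ a b c d e → (a :+ c) :+ ((b :+ d) :+ e) := (a :+ b) :+ (c :+ d) :+ e) refl
               (single i 1# j) (single j α j) (single i (- 1#) j) (single j′ β j) (single l γ j) ⟩
        relation i j i j′ l j ≡⟨ zero-relation j ⟩
        0# ∎
      rest : (j ≡ j′ × single j′ β j ≡ β) ⊎ (j ≢ j′ × single j′ β j ≡ 0#) →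
             (j ≡ l × single l γ j ≡ γ) ⊎ (j ≢ l × single l γ j ≡ 0#) → j ≡ j′ × j ≡ l
      rest (inj₁ (j≡j′ , _)) (inj₁ (j≡l , _)) = j≡j′ , j≡l
      rest (inj₁ (_ , b≡β)) (inj₂ (_ , c≡0)) = contradiction (here (begin
        α + β       ≡⟨ +-identityʳ _ ⟨
        α + β + 0#  ≡⟨ cong₂ (λ b c → α + b + c) b≡β c≡0 ⟨
        _           ≡⟨ at-j ⟩
        0#          ∎)) α+β∉
      rest (inj₂ (_ , b≡0)) (inj₁ (_ , c≡γ)) = contradiction (here (begin
        β                ≡⟨ +-identityʳ β ⟨
        β + 0#           ≡⟨ cong (β +_) (trans (sym at-j) (cong₂ (λ b c → α + b + c) b≡0 c≡γ)) ⟩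
        β + (α + 0# + γ) ≡⟨ solve 3 (λ a b c → b :+ (a :+ con 0 :+ c) := a :+ b :+ c) refl α β γ ⟩
        α + β + γ        ≡⟨ α+β+γ≡0 ⟩
        0#               ∎)) β∉
      rest (inj₂ (_ , b≡0)) (inj₂ (_ , c≡0)) = contradiction (here (begin
        α            ≡⟨ trans (+-identityʳ _) (+-identityʳ α) ⟨
        α + 0# + 0#  ≡⟨ cong₂ (λ b c → α + b + c) b≡0 c≡0 ⟨
        _            ≡⟨ at-j ⟩
        0#           ∎)) α∉

-- The bound on the length

-- If `z ≥ D`, then `x + y ≤ B - D`, and the smaller of `x` and `y` is at most half of that.
degree-trichotomy : ∀ x y z {D B} → x ℕ.+ y ℕ.+ z ℕ.≤ B →
  z ℕ.< D ⊎ 2 ℕ.* x ℕ.+ D ℕ.≤ B ⊎ 2 ℕ.* y ℕ.+ D ℕ.≤ B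
degree-trichotomy x y z {D} sum≤B with z ℕ.<? D
... | yes z<D = inj₁ z<D
... | no  z≮D with ℕ.≤-total x y
...   | inj₁ x≤y = inj₂ (inj₁ (ℕ.≤-trans (ℕ.+-mono-≤ (twice x≤y) (ℕ.≮⇒≥ z≮D)) sum≤B))
  where
  twice : ∀ {x y} → x ℕ.≤ y → 2 ℕ.* x ℕ.≤ x ℕ.+ y
  twice {x} x≤y = ℕ.+-monoʳ-≤ x (ℕ.≤-trans (ℕ.≤-reflexive (ℕ.+-identityʳ x)) x≤y)
...   | inj₂ y≤x = inj₂ (inj₂ (ℕ.≤-trans (ℕ.+-mono-≤ (twice y≤x) (ℕ.≮⇒≥ z≮D)) sum≤B))
  where
  twice : ∀ {x y} → y ℕ.≤ x → 2 ℕ.* y ℕ.≤ x ℕ.+ y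
  twice {x} {y} y≤x = ℕ.+-mono-≤ y≤x (ℕ.≤-reflexive (ℕ.+-identityʳ y))

module CodeBound {Q : ℕ} (F : FiniteField (suc Q)) (coefs : Weights.Coefficients F) where
  open LinearAlgebra F
  open Polynomials F
  open Counting using (degree; belowMean; lowDegree; ∈-belowMean; ∈-lowDegree)
  open Weights F
  open Relation coefs
  open ≡-Reasoning

  module _ {n k : ℕ} (code : LinearCode n k 6) (dual : Annihilator (LinearCode.G code)) where
    open LinearCode code
    private module H = Annihilator dual

    r : ℕ
    r = H.dim

    -- The vectors `H.σ` are the rows of a parity check matrix.
    syndrome : Word n → Word r
    syndrome x κ = ⟨ x , H.σ κ ⟩

    redundancy : r ≡ n ℕ.∸ k
    redundancy = trans (sym (ℕ.m+n∸n≡m r k)) (cong (ℕ._∸ k) (H.exact indep))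

    -- By `span` a zero syndrome makes `x` a codeword, and nonzero codewords have weight at least 6.
    light-zero : ∀ x → wt x ℕ.≤ 5 → IsZero (syndrome x) → IsZero x
    light-zero x light Hx≡0 with H.span x Hx≡0
    ... | c , c·G≗x with all? (λ i → x i ≟ 0#)
    ...   | yes x≡0 = x≡0
    ...   | no  x≢0 = contradiction
              (ℕ.≤-trans (min-dist c (λ c·G≡0 → x≢0 (λ i → trans (sym (c·G≗x i)) (c·G≡0 i))))
                (ℕ.≤-reflexive (wt-cong c·G≗x)))
              (ℕ.<⇒≱ (s≤s light))

    Δ-relation : ∀ i j i′ j′ l → Carrier
    Δ-relation i j i′ j′ l = Δ (λ κ → syndrome (U i j) κ + syndrome (W i′ j′) κ + syndrome (Y l) κ)

    syndrome-relation : ∀ i j i′ j′ l κ →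
      syndrome (relation i j i′ j′ l) κ ≡ syndrome (U i j) κ + syndrome (W i′ j′) κ + syndrome (Y l) κ
    syndrome-relation i j i′ j′ l κ = trans (⟨⟩-+ˡ (λ m → U i j m + W i′ j′ m) (Y l) (H.σ κ))
      (cong (_+ syndrome (Y l) κ) (⟨⟩-+ˡ (U i j) (W i′ j′) (H.σ κ)))

    Δ-diagonal : ∀ i j → Δ-relation i j i j j ≡ 1#
    Δ-diagonal i j = Δ-zero (λ κ → trans (sym (syndrome-relation i j i j j κ))
      (sum-zero (λ m → trans (cong (_* H.σ κ m) (relation-diagonal i j m)) (zeroˡ _))))

    -- If the syndrome were zero, the relation, of weight at most five, would vanish by
    -- `light-zero`, and `relation-trivial` would apply.
    Δ-off-diagonal : ∀ {i j i′ j′ l} → ¬ (i ≡ i′ × j ≡ j′ × j ≡ l) → Δ-relation i j i′ j′ l ≡ 0#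
    Δ-off-diagonal {i} {j} {i′} {j′} {l} nontrivial = Δ-nonzero _ κ
      (subst (_≢ 0#) (syndrome-relation i j i′ j′ l κ) Hxκ≢0)
      where
      κ,≢0 = ¬∀⟶∃¬ r _ (λ κ → syndrome (relation i j i′ j′ l) κ ≟ 0#) (λ Hx≡0 →
        nontrivial (relation-trivial i j i′ j′ l (light-zero _ (wt-relation i j i′ j′ l) Hx≡0)))
      κ = proj₁ κ,≢0
      Hxκ≢0 = proj₂ κ,≢0

    module Grid (D : ℕ)
      (ann₀ : Annihilator (λ e l → monomial (lookup (lowDegree r D) e) (syndrome (Y l)))) where
      private module A₀ = Annihilator ann₀

      half = belowMean Q r D
      s = A₀.dim

      -- Like each basis vector, their sum is orthogonal to the monomials of low degree; by the
      -- reduced form it equals `1#` on all `s` coordinates `A₀.ι` at once.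
      g : Word n
      g l = sum (λ k → A₀.σ k l)

      g-ι : ∀ m → g (A₀.ι m) ≡ 1#
      g-ι m = trans (sum-single (λ k → A₀.σ k (A₀.ι m)) m (λ k k≢m → A₀.σ-ι′ k m k≢m)) (A₀.σ-ι m)

      ι₀-injective : ∀ {j j′} → A₀.ι j ≡ A₀.ι j′ → j ≡ j′
      ι₀-injective {j} {j′} eq with j Fin.≟ j′
      ... | yes j≡j′ = j≡j′
      ... | no  j≢j′ = contradiction (trans (sym (A₀.σ-ι j)) (trans (cong (A₀.σ j) eq) (A₀.σ-ι′ j j′ j≢j′))) 1≢0

      -- The index `p` encodes a pair whose second member runs only over coordinates where `g` is
      -- `1#`, so that the diagonal entries are nonzero.
      fst : Fin (n ℕ.* s) → Fin n
      fst p = proj₁ (remQuot {n} s p)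
      snd : Fin (n ℕ.* s) → Fin n
      snd p = A₀.ι (proj₂ (remQuot {n} s p))

      pair-injective : ∀ {p p′} → fst p ≡ fst p′ → snd p ≡ snd p′ → p ≡ p′
      pair-injective {p} {p′} eq₁ eq₂ = begin
        p                                         ≡⟨ combine-remQuot {n} s p ⟨
        combine (fst p) (proj₂ (remQuot {n} s p)) ≡⟨ cong₂ (combine {n} {s}) eq₁ (ι₀-injective eq₂) ⟩
        combine (fst p′) (proj₂ (remQuot {n} s p′)) ≡⟨ combine-remQuot {n} s p′ ⟩
        p′                                        ∎

      u w : Fin (n ℕ.* s) → Word r
      u p = syndrome (U (fst p) (snd p))
      w p = syndrome (W (fst p) (snd p))

      module Contradiction
        (ann₁ : Annihilator (λ e p → monomial (lookup half e) (u p)))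
        (ann₂ : Annihilator (λ e k → monomial (lookup half e) (w (Annihilator.ι ann₁ k)))) where
        private
          module A₁ = Annihilator ann₁
          module A₂ = Annihilator ann₂

        -- The comparison of ranks, made by evaluating one trilinear form twice. Diagonality gives
        -- `1#`; expanding `Δ` gives `0#`, because every monomial has a factor killed by `v`, `t` or
        -- `g`.
        impossible : ¬ Fin A₂.dim
        impossible z = 1≢0 (trans (sym value-one) value-zero)
          where
          -- `v` kills monomials in the row pairs and `t` those in the column pairs. `A₂` lives on
          -- the coordinates `A₁.ι`, where the `A₁.σ` form the identity matrix, so `v` singles out
          -- `k₀`, and there `t` is `1#`.
          t = A₂.σ z
          k₀ = A₂.ι z
          v = A₁.σ k₀

          entry : Fin A₁.dim × Fin (n ℕ.* s) × Fin n → Carrier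
          entry (k , p , l) = Δ-relation (fst p) (snd p) (fst (A₁.ι k)) (snd (A₁.ι k)) l

          entry-diagonal : ∀ k → entry (k , A₁.ι k , snd (A₁.ι k)) ≡ 1#
          entry-diagonal k = Δ-diagonal (fst (A₁.ι k)) (snd (A₁.ι k))

          over-l : ∀ k → ⟨ g , (λ l → entry (k , A₁.ι k , l)) ⟩ ≡ 1#
          over-l k = begin
            ⟨ g , (λ l → entry (k , A₁.ι k , l)) ⟩
              ≡⟨ sum-single _ (snd (A₁.ι k)) (λ l l≢ → trans
                   (cong (g l *_) (Δ-off-diagonal (λ (_ , _ , snd≡l) → l≢ (sym snd≡l)))) (zeroʳ _)) ⟩
            g (snd (A₁.ι k)) * entry (k , A₁.ι k , snd (A₁.ι k))
              ≡⟨ cong₂ _*_ (g-ι _) (entry-diagonal k) ⟩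
            1# * 1#
              ≡⟨ *-identityˡ 1# ⟩
            1# ∎

          over-p : ∀ k → ⟨ v , (λ p → ⟨ g , (λ l → entry (k , p , l)) ⟩) ⟩ ≡ v (A₁.ι k)
          over-p k = begin
            ⟨ v , (λ p → ⟨ g , (λ l → entry (k , p , l)) ⟩) ⟩
              ≡⟨ sum-single _ (A₁.ι k) (λ p p≢ → trans (cong (v p *_) (sum-zero (λ l → trans
                   (cong (g l *_) (Δ-off-diagonal (λ (fst≡ , snd≡ , _) → p≢ (pair-injective fst≡ snd≡)))) (zeroʳ _))))
                   (zeroʳ _)) ⟩
            v (A₁.ι k) * ⟨ g , (λ l → entry (k , A₁.ι k , l)) ⟩
              ≡⟨ cong (v (A₁.ι k) *_) (over-l k) ⟩
            v (A₁.ι k) * 1#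
              ≡⟨ *-identityʳ _ ⟩
            v (A₁.ι k) ∎

          value-one : trilinear t v g entry ≡ 1#
          value-one = begin
            trilinear t v g entry
              ≡⟨ ⟨⟩-cong t over-p ⟩
            ⟨ t , (λ k → v (A₁.ι k)) ⟩
              ≡⟨ sum-single _ k₀ (λ k k≢k₀ → trans (cong (t k *_) (A₁.σ-ι′ k₀ k (k≢k₀ ∘ sym))) (zeroʳ _)) ⟩
            t k₀ * v (A₁.ι k₀)
              ≡⟨ cong₂ _*_ (A₂.σ-ι z) (A₁.σ-ι k₀) ⟩
            1# * 1#
              ≡⟨ *-identityˡ 1# ⟩
            1# ∎

          Null : (Fin A₁.dim × Fin (n ℕ.* s) × Fin n → Carrier) → Set
          Null f = trilinear t v g f ≡ 0#

          open Expansion Null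
            (λ f≗f′ null → trans (sym (trilinear-cong t v g f≗f′)) null)
            (λ {f} {f′} c null null′ → trans (trilinear-linear t v g f f′ c)
              (trans (cong₂ (λ x y → x + c * y) null null′) (trans (+-identityˡ _) (zeroʳ c))))

          killed : ∀ {A : Set} {m} (f : A → Word m) (y : Word m) {xs : List A} {x} → x ∈ xs →
            (∀ j → ⟨ f (lookup xs j) , y ⟩ ≡ 0#) → ⟨ y , f x ⟩ ≡ 0#
          killed f y x∈xs kills = trans (⟨⟩-comm y _)
            (trans (cong (λ x → ⟨ f x , y ⟩) (lookup-index x∈xs)) (kills (Any.index x∈xs)))

          value-zero : trilinear t v g entry ≡ 0#
          value-zero = trans (sym (trilinear-cong t v g (λ x → *-identityˡ (entry x))))
            (Δ-null (ℕ.s≤s⁻¹ length-units) (λ _ → 1#)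
              (λ (k , p , l) → u p) (λ (k , p , l) → w (A₁.ι k)) (λ (k , p , l) → syndrome (Y l))
              (λ e f h e≤Q f≤Q degree≤ →
                trans (trilinear-cong t v g (λ x → *-identityˡ _))
                (trans (trilinear-product t v g (λ p → monomial e (u p)) (λ k → monomial f (w (A₁.ι k))) (λ l → monomial h (syndrome (Y l))))
                (product-zero e f h (e-or-f-or-h e f h e≤Q f≤Q degree≤)))))
            where
            ⟨v,_⟩ ⟨t,_⟩ ⟨g,_⟩ : Vec ℕ r → Carrier
            ⟨v, e ⟩ = ⟨ v , (λ p → monomial e (u p)) ⟩
            ⟨t, f ⟩ = ⟨ t , (λ k → monomial f (w (A₁.ι k))) ⟩
            ⟨g, h ⟩ = ⟨ g , (λ l → monomial h (syndrome (Y l))) ⟩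

            e-or-f-or-h : ∀ e f h → _ → _ → degree e ℕ.+ degree f ℕ.+ degree h ℕ.≤ Q ℕ.* r →
              ⟨g, h ⟩ ≡ 0# ⊎ ⟨v, e ⟩ ≡ 0# ⊎ ⟨t, f ⟩ ≡ 0#
            e-or-f-or-h e f h e≤Q f≤Q degree≤ with degree-trichotomy (degree e) (degree f) (degree h) {D} degree≤
            ... | inj₁ h<D         = inj₁ (killed (λ h l → monomial h (syndrome (Y l))) g (∈-lowDegree h h<D) (λ j → ⟨⟩-sum (λ l → monomial (lookup (lowDegree r D) j) (syndrome (Y l))) A₀.σ (A₀.kills j)))
            ... | inj₂ (inj₁ elow) = inj₂ (inj₁ (killed (λ e p → monomial e (u p)) v (∈-belowMean e≤Q elow) (λ j → A₁.kills j k₀)))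
            ... | inj₂ (inj₂ flow) = inj₂ (inj₂ (killed (λ f k → monomial f (w (A₁.ι k))) t (∈-belowMean f≤Q flow) (λ j → A₂.kills j z)))

            product-zero : ∀ e f h → ⟨g, h ⟩ ≡ 0# ⊎ ⟨v, e ⟩ ≡ 0# ⊎ ⟨t, f ⟩ ≡ 0# →
              ⟨v, e ⟩ * (⟨t, f ⟩ * ⟨g, h ⟩) ≡ 0#
            product-zero e f h (inj₁ gh≡0) = trans (cong (λ x → ⟨v, e ⟩ * (⟨t, f ⟩ * x)) gh≡0)
              (trans (cong (⟨v, e ⟩ *_) (zeroʳ _)) (zeroʳ _))
            product-zero e f h (inj₂ (inj₁ ve≡0)) = trans (cong (_* (⟨t, f ⟩ * ⟨g, h ⟩)) ve≡0) (zeroˡ _)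
            product-zero e f h (inj₂ (inj₂ tf≡0)) = trans (cong (λ x → ⟨v, e ⟩ * (x * ⟨g, h ⟩)) tf≡0)
              (trans (cong (⟨v, e ⟩ *_) (zeroˡ _)) (zeroʳ _))

    dim-zero : ∀ {m} → ¬ Fin m → m ≡ 0
    dim-zero {zero}  _ = refl
    dim-zero {suc m} e = contradiction zero e

    -- Two dimension counts, each losing `length half`, lead from `n * s` to the dimension of the
    -- second annihilator, which `impossible` makes zero.
    size-bound : ∀ D → ∃ λ s → n ℕ.≤ s ℕ.+ length (lowDegree r D) ×
      n ℕ.* s ℕ.≤ 2 ℕ.* length (belowMean Q r D)
    size-bound D = with-annihilators (annihilator _)
      where
      half = belowMean Q r D
      with-annihilators : Annihilator (λ e l → monomial (lookup (lowDegree r D) e) (syndrome (Y l))) → _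
      with-annihilators ann₀ = s , Annihilator.large ann₀ , bound (annihilator _) (annihilator _)
        where
        open Grid D ann₀ using (s; u; w; module Contradiction)
        bound : (ann₁ : Annihilator (λ e p → monomial (lookup half e) (u p))) →
          Annihilator (λ e k → monomial (lookup half e) (w (Annihilator.ι ann₁ k))) → n ℕ.* s ℕ.≤ 2 ℕ.* length half
        bound ann₁ ann₂ = ℕ.≤-trans (Annihilator.large ann₁) (ℕ.≤-trans
          (ℕ.+-monoˡ-≤ (length half) (subst (λ d → Annihilator.dim ann₁ ℕ.≤ d ℕ.+ length half)
            (dim-zero (Contradiction.impossible ann₁ ann₂)) (Annihilator.large ann₂)))
          (ℕ.≤-reflexive (cong (length half ℕ.+_) (sym (ℕ.+-identityʳ (length half))))))

open import Data.Nat using (_*_; _^_; _≤_; _∸_)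

-- Logarithms to base `q` turn the inequality into `k ≤ n - 2 log_q n - M`; that `ω` tends to
-- infinity means that every `M` has such an `N`.
theorem1p3 : (q : ℕ) → OddPrimePower q → 7 ≤ q → (F : FiniteField q) →
    ∀ (M : ℕ) → ∃ λ (N : ℕ) → ∀ (n k : ℕ) → N ≤ n →
    Coding.LinearCode F n k 6 → (q ^ M) * (n * n) ≤ q ^ (n ∸ k)
theorem1p3 (suc Q) _ 7≤q@(s≤s 6≤Q) F M = N , bound
  where
  open Counting
  open Asymptotics Q (suc Q ^ M) 6≤Q
  open CodeBound F (Weights.coefficients F 7≤q)
  bound : ∀ n k → N ≤ n → Coding.LinearCode F n k 6 → (suc Q ^ M) * (n * n) ≤ suc Q ^ (n ∸ k)
  bound n k N≤n code =
    let dual               = LinearAlgebra.annihilator F (Coding.LinearCode.G code)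
        ρ                  = r code dual
        -- The estimate is used twice. For `D = 0` no exponents are excluded, and the crude bound
        -- forces `r₀ ≤ ρ`; this makes `D = ρ / 3` large enough for the second use.
        s , n≤s+0 , n*s≤2K = size-bound code dual 0
        r₀≤ρ               = r₀≤r N≤n (subst (n ≤_) (trans (cong (s ℕ.+_) (length-lowDegree-0 ρ)) (ℕ.+-identityʳ s)) n≤s+0) n*s≤2K (length-belowMean Q ρ 0)
        s′ , n≤s+L , n*s′≤2K = size-bound code dual (ρ ℕ./ 3)
    in subst (λ r → (suc Q ^ M) * (n * n) ≤ suc Q ^ r) (redundancy code dual)
         (quadratic-bound {K = length (belowMean Q ρ (ρ ℕ./ 3))} r₀≤ρ (length-lowDegree ρ (ρ ℕ./ 3)) (belowMean-rare Q ρ (ρ ℕ./ 3)) n≤s+L n*s′≤2K)
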